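{- Let $d>2$ be an integer. There is a constant $C_d$ such that for every integer $n\ge 2$ and every set $\mathcal{O}$ of obstructing unit $d$-hypercubes in $[0,n]^d$, the number of hypercubes in $\mathcal{O}$ that are visible from the observer hypercube $[0,1]^d$, in the setting where light fails to interact with any obstruction that does not block it at the angle $45^\circ$, is at most $C_d\,n^{d-\frac1d}\log n$.
   Context: The hypercube $[0,n]^d$ is partitioned into axis-aligned unit $d$-hypercubes $\prod_{i=1}^d[a_i,a_i+1]$ with $a_i\in\{0,\dots,n-1\}$. The observer is the unit hypercube $[0,1]^d$ at the origin; a set $\mathcal{O}$ of other unit hypercubes of the partition is declared obstructing. A $d$-dimensional hypercube blocks a ray of light at the angle $\theta$ if the ray intersects some $(d-1)$-dimensional facet of the hypercube at an angle at most $90^\circ-\theta$ away from the normal vector (line) to that facet. In the setting of the theorem, light passes freely through any obstruction which does not block it at the angle $45^\circ$. Precisely, an obstructing hypercube $Q\in\mathcal{O}$ is visible if there are a point $x$ of the observer hypercube and a point $y\neq x$ on some facet $F$ of $Q$ such that the direction of the segment from $x$ to $y$ makes an angle at most $45^\circ$ with the normal line of $F$, and such that, apart from the point $y$, the segment from $x$ to $y$ meets no facet $F'$ of a hypercube $Q'\in\mathcal{O}$, $Q'\ne Q$, for which the direction of the segment makes an angle at most $45^\circ$ with the normal line of $F'$. -}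

module Defs where

open import Algebra.Bundles using (CommutativeMonoid)
open import Data.Bool using (Bool; if_then_else_)
open import Data.Fin using (Fin; toℕ)
open import Data.Fin.Properties using () renaming (_≟_ to _≟F_)
import Data.Integer as ℤ
open import Data.List using (length)
open import Data.List.Relation.Unary.All using (All)
open import Data.List.Relation.Unary.Unique.Propositional using (Unique)
open import Data.Nat as ℕ using (ℕ; _^_)
import Data.Nat.Properties as ℕP
open import Data.Product using (∃-syntax; _×_; _,_)
open import Data.Rational as ℚ using (ℚ; 0ℚ; 1ℚ; ½)
import Data.Rational.Properties as ℚP
open import Data.Vec using (Vec; lookup)
open import Data.Vec.Functional using (Vector; foldr)
open import Level using (0ℓ)
open import Relation.Binary.PropositionalEquality
open import Relation.Nullary using (¬_; does)
open import Relation.Unary using (Pred; _∈_)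

------------------------------------------------------------------------
-- Real numbers: Cauchy sequences of rationals, compared with _≈ℝ_ and
-- with all operations taken termwise.

Eventually : Pred ℕ 0ℓ → Set
Eventually P = ∃[ k ] ∀ i → k ℕ.≤ i → P i

IsCauchy : (ℕ → ℚ) → Set
IsCauchy s = ∀ ε → 0ℚ ℚ.< ε →
  ∃[ k ] ∀ i j → k ℕ.≤ i → k ℕ.≤ j → ℚ.∣ s i ℚ.- s j ∣ ℚ.< ε

record ℝ : Set where
  constructor mkℝ
  field
    seq    : ℕ → ℚ
    cauchy : IsCauchy seq

open ℝ public

infix 4 _≤ℝ_ _<ℝ_ _≈ℝ_

_≤ℝ_ _<ℝ_ _≈ℝ_ : ℝ → ℝ → Set
x ≤ℝ y = ∀ ε → 0ℚ ℚ.< ε → Eventually (λ i → seq x i ℚ.≤ seq y i ℚ.+ ε)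
x <ℝ y = ∃[ ε ] 0ℚ ℚ.< ε × Eventually (λ i → seq x i ℚ.+ ε ℚ.≤ seq y i)
x ≈ℝ y = x ≤ℝ y × y ≤ℝ x

half-pos : ∀ {ε} → 0ℚ ℚ.< ε → 0ℚ ℚ.< ½ ℚ.* ε
half-pos {ε} 0<ε = subst (ℚ._< ½ ℚ.* ε) (ℚP.*-zeroʳ ½) (ℚP.*-monoʳ-<-pos ½ 0<ε)

halves : ∀ ε → ½ ℚ.* ε ℚ.+ ½ ℚ.* ε ≡ ε
halves ε = trans (sym (ℚP.*-distribʳ-+ ε ½ ½)) (ℚP.*-identityˡ ε)

-+-cancel : ∀ p q → (p ℚ.- q) ℚ.+ q ≡ p
-+-cancel p q = begin
  (p ℚ.- q) ℚ.+ q     ≡⟨ ℚP.+-assoc p (ℚ.- q) q ⟩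
  p ℚ.+ (ℚ.- q ℚ.+ q) ≡⟨ cong (p ℚ.+_) (ℚP.+-inverseˡ q) ⟩
  p ℚ.+ 0ℚ            ≡⟨ ℚP.+-identityʳ p ⟩
  p                   ∎
  where open ≡-Reasoning

+-diff : ∀ p q r s → (p ℚ.+ q) ℚ.- (r ℚ.+ s) ≡ (p ℚ.- r) ℚ.+ (q ℚ.- s)
+-diff p q r s = begin
  (p ℚ.+ q) ℚ.- (r ℚ.+ s)           ≡⟨ cong (p ℚ.+ q ℚ.+_) (ℚP.neg-distrib-+ r s) ⟩
  (p ℚ.+ q) ℚ.+ (ℚ.- r ℚ.+ ℚ.- s)   ≡⟨ interchange p q (ℚ.- r) (ℚ.- s) ⟩
  (p ℚ.- r) ℚ.+ (q ℚ.- s)           ∎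
  where
  open ≡-Reasoning
  open import Algebra.Properties.CommutativeSemigroup
    (CommutativeMonoid.commutativeSemigroup ℚP.+-0-commutativeMonoid)

*-diff : ∀ p q r s → p ℚ.* q ℚ.- r ℚ.* s ≡ p ℚ.* (q ℚ.- s) ℚ.+ s ℚ.* (p ℚ.- r)
*-diff p q r s = sym (begin
  p ℚ.* (q ℚ.- s) ℚ.+ s ℚ.* (p ℚ.- r)
    ≡⟨ cong₂ ℚ._+_ (*-distrib-diff p q s) (*-distrib-diff s p r) ⟩
  (p ℚ.* q ℚ.- p ℚ.* s) ℚ.+ (s ℚ.* p ℚ.- s ℚ.* r)
    ≡⟨ cong₂ (λ u v → (p ℚ.* q ℚ.- p ℚ.* s) ℚ.+ (u ℚ.- v)) (ℚP.*-comm s p) (ℚP.*-comm s r) ⟩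
  (p ℚ.* q ℚ.- p ℚ.* s) ℚ.+ (p ℚ.* s ℚ.- r ℚ.* s)
    ≡⟨ sym (ℚP.+-assoc (p ℚ.* q ℚ.- p ℚ.* s) (p ℚ.* s) (ℚ.- (r ℚ.* s))) ⟩
  ((p ℚ.* q ℚ.- p ℚ.* s) ℚ.+ p ℚ.* s) ℚ.- r ℚ.* s
    ≡⟨ cong (ℚ._- (r ℚ.* s)) (-+-cancel (p ℚ.* q) (p ℚ.* s)) ⟩
  p ℚ.* q ℚ.- r ℚ.* s ∎)
  where
  open ≡-Reasoning
  *-distrib-diff : ∀ a b c → a ℚ.* (b ℚ.- c) ≡ a ℚ.* b ℚ.- a ℚ.* c
  *-distrib-diff a b c = trans (ℚP.*-distribˡ-+ a b (ℚ.- c))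
    (cong (a ℚ.* b ℚ.+_) (sym (ℚP.neg-distribʳ-* a c)))

const-cauchy : ∀ p → IsCauchy (λ _ → p)
const-cauchy p ε 0<ε =
  0 , λ _ _ _ _ → subst (ℚ._< ε) (sym (cong ℚ.∣_∣ (ℚP.+-inverseʳ p))) 0<ε

neg-cauchy : ∀ {s} → IsCauchy s → IsCauchy (λ i → ℚ.- s i)
neg-cauchy {s} cs ε 0<ε with cs ε 0<ε
... | k , h = k , λ i j k≤i k≤j →
  subst (ℚ._< ε)
    (trans (sym (ℚP.∣-p∣≡∣p∣ (s i ℚ.- s j)))
           (cong ℚ.∣_∣ (ℚP.neg-distrib-+ (s i) (ℚ.- s j))))
    (h i j k≤i k≤j)

+-cauchy : ∀ {s t} → IsCauchy s → IsCauchy t → IsCauchy (λ i → s i ℚ.+ t i)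
+-cauchy {s} {t} cs ct ε 0<ε with cs (½ ℚ.* ε) (half-pos 0<ε) | ct (½ ℚ.* ε) (half-pos 0<ε)
... | k , h | l , g = k ℕ.+ l , λ i j ki kj → begin-strict
    ℚ.∣ (s i ℚ.+ t i) ℚ.- (s j ℚ.+ t j) ∣
      ≡⟨ cong ℚ.∣_∣ (+-diff (s i) (t i) (s j) (t j)) ⟩
    ℚ.∣ (s i ℚ.- s j) ℚ.+ (t i ℚ.- t j) ∣
      ≤⟨ ℚP.∣p+q∣≤∣p∣+∣q∣ (s i ℚ.- s j) (t i ℚ.- t j) ⟩
    ℚ.∣ s i ℚ.- s j ∣ ℚ.+ ℚ.∣ t i ℚ.- t j ∣
      <⟨ ℚP.+-mono-< (h i j (ℕP.m+n≤o⇒m≤o k ki) (ℕP.m+n≤o⇒m≤o k kj))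
                     (g i j (ℕP.m+n≤o⇒n≤o k ki) (ℕP.m+n≤o⇒n≤o k kj)) ⟩
    ½ ℚ.* ε ℚ.+ ½ ℚ.* ε
      ≡⟨ halves ε ⟩
    ε ∎
  where open ℚP.≤-Reasoning

bounded : ∀ {s} → IsCauchy s →
          ∃[ b ] 0ℚ ℚ.< b × Eventually (λ i → ℚ.∣ s i ∣ ℚ.≤ b)
bounded {s} cs with cs 1ℚ (ℚP.positive⁻¹ 1ℚ)
... | k , h = 1ℚ ℚ.+ ℚ.∣ s k ∣ , pos , k , λ i k≤i → begin
    ℚ.∣ s i ∣
      ≡⟨ cong ℚ.∣_∣ (sym (-+-cancel (s i) (s k))) ⟩
    ℚ.∣ (s i ℚ.- s k) ℚ.+ s k ∣
      ≤⟨ ℚP.∣p+q∣≤∣p∣+∣q∣ (s i ℚ.- s k) (s k) ⟩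
    ℚ.∣ s i ℚ.- s k ∣ ℚ.+ ℚ.∣ s k ∣
      ≤⟨ ℚP.+-monoˡ-≤ ℚ.∣ s k ∣ (ℚP.<⇒≤ (h i k k≤i ℕP.≤-refl)) ⟩
    1ℚ ℚ.+ ℚ.∣ s k ∣ ∎
  where
  open ℚP.≤-Reasoning
  pos : 0ℚ ℚ.< 1ℚ ℚ.+ ℚ.∣ s k ∣
  pos = ℚP.+-mono-<-≤ (ℚP.positive⁻¹ 1ℚ) (ℚP.0≤∣p∣ (s k))

quotient : ∀ b ε → 0ℚ ℚ.< b → 0ℚ ℚ.< ε → ∃[ δ ] 0ℚ ℚ.< δ × b ℚ.* δ ≡ ε
quotient b ε 0<b 0<ε = ℚ.1/ b ℚ.* ε , pos , eq
  where
  instance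
    _ = ℚ.positive 0<b
    _ = ℚP.pos⇒nonZero b
    _ = ℚP.1/pos⇒pos b
  pos : 0ℚ ℚ.< ℚ.1/ b ℚ.* ε
  pos = subst (ℚ._< ℚ.1/ b ℚ.* ε) (ℚP.*-zeroʳ (ℚ.1/ b)) (ℚP.*-monoʳ-<-pos (ℚ.1/ b) 0<ε)
  eq : b ℚ.* (ℚ.1/ b ℚ.* ε) ≡ ε
  eq = trans (sym (ℚP.*-assoc b (ℚ.1/ b) ε))
             (trans (cong (ℚ._* ε) (ℚP.*-inverseʳ b)) (ℚP.*-identityˡ ε))

*-bound : ∀ p q b δ → 0ℚ ℚ.< b → ℚ.∣ p ∣ ℚ.≤ b → ℚ.∣ q ∣ ℚ.< δ →
          ℚ.∣ p ℚ.* q ∣ ℚ.< b ℚ.* δ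
*-bound p q b δ 0<b p≤b q<δ = begin-strict
    ℚ.∣ p ℚ.* q ∣            ≡⟨ ℚP.∣p*q∣≡∣p∣*∣q∣ p q ⟩
    ℚ.∣ p ∣ ℚ.* ℚ.∣ q ∣      ≤⟨ ℚP.*-monoʳ-≤-nonNeg ℚ.∣ q ∣ {{ℚP.∣-∣-nonNeg q}} p≤b ⟩
    b ℚ.* ℚ.∣ q ∣            <⟨ ℚP.*-monoʳ-<-pos b {{ℚ.positive 0<b}} q<δ ⟩
    b ℚ.* δ                  ∎
  where open ℚP.≤-Reasoning

*-cauchy : ∀ {s t} → IsCauchy s → IsCauchy t → IsCauchy (λ i → s i ℚ.* t i)
*-cauchy {s} {t} cs ct ε 0<ε with bounded {s} cs | bounded {t} ct
... | b , 0<b , K , s≤b | c , 0<c , L , t≤c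
  with quotient b (½ ℚ.* ε) 0<b (half-pos 0<ε) | quotient c (½ ℚ.* ε) 0<c (half-pos 0<ε)
... | δ , 0<δ , bδ | η , 0<η , cη with ct δ 0<δ | cs η 0<η
... | M , ht | N , hs = (K ℕ.+ L) ℕ.+ (M ℕ.+ N) , λ i j ki kj → begin-strict
    ℚ.∣ s i ℚ.* t i ℚ.- s j ℚ.* t j ∣
      ≡⟨ cong ℚ.∣_∣ (*-diff (s i) (t i) (s j) (t j)) ⟩
    ℚ.∣ s i ℚ.* (t i ℚ.- t j) ℚ.+ t j ℚ.* (s i ℚ.- s j) ∣
      ≤⟨ ℚP.∣p+q∣≤∣p∣+∣q∣ (s i ℚ.* (t i ℚ.- t j)) (t j ℚ.* (s i ℚ.- s j)) ⟩
    ℚ.∣ s i ℚ.* (t i ℚ.- t j) ∣ ℚ.+ ℚ.∣ t j ℚ.* (s i ℚ.- s j) ∣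
      <⟨ ℚP.+-mono-<
           (*-bound (s i) (t i ℚ.- t j) b δ 0<b (s≤b i (toK ki)) (ht i j (toM ki) (toM kj)))
           (*-bound (t j) (s i ℚ.- s j) c η 0<c (t≤c j (toL kj)) (hs i j (toN ki) (toN kj))) ⟩
    b ℚ.* δ ℚ.+ c ℚ.* η
      ≡⟨ cong₂ ℚ._+_ bδ cη ⟩
    ½ ℚ.* ε ℚ.+ ½ ℚ.* ε
      ≡⟨ halves ε ⟩
    ε ∎
  where
  open ℚP.≤-Reasoning
  toK : ∀ {i} → (K ℕ.+ L) ℕ.+ (M ℕ.+ N) ℕ.≤ i → K ℕ.≤ i
  toK h = ℕP.m+n≤o⇒m≤o K (ℕP.m+n≤o⇒m≤o (K ℕ.+ L) h)
  toL : ∀ {i} → (K ℕ.+ L) ℕ.+ (M ℕ.+ N) ℕ.≤ i → L ℕ.≤ i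
  toL h = ℕP.m+n≤o⇒n≤o K (ℕP.m+n≤o⇒m≤o (K ℕ.+ L) h)
  toM : ∀ {i} → (K ℕ.+ L) ℕ.+ (M ℕ.+ N) ℕ.≤ i → M ℕ.≤ i
  toM h = ℕP.m+n≤o⇒m≤o M (ℕP.m+n≤o⇒n≤o (K ℕ.+ L) h)
  toN : ∀ {i} → (K ℕ.+ L) ℕ.+ (M ℕ.+ N) ℕ.≤ i → N ℕ.≤ i
  toN h = ℕP.m+n≤o⇒n≤o M (ℕP.m+n≤o⇒n≤o (K ℕ.+ L) h)

infix  8 -ℝ_
infixl 7 _*ℝ_
infixl 6 _+ℝ_ _-ℝ_

fromℚ : ℚ → ℝ
fromℚ p = mkℝ (λ _ → p) (const-cauchy p)

fromℕ : ℕ → ℝ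
fromℕ n = fromℚ (ℤ.+ n ℚ./ 1)

0ℝ 1ℝ : ℝ
0ℝ = fromℕ 0
1ℝ = fromℕ 1

-ℝ_ : ℝ → ℝ
-ℝ x = mkℝ (λ i → ℚ.- seq x i) (neg-cauchy {seq x} (cauchy x))

_+ℝ_ _-ℝ_ _*ℝ_ : ℝ → ℝ → ℝ
x +ℝ y = mkℝ (λ i → seq x i ℚ.+ seq y i) (+-cauchy {seq x} {seq y} (cauchy x) (cauchy y))
x -ℝ y = x +ℝ (-ℝ y)
x *ℝ y = mkℝ (λ i → seq x i ℚ.* seq y i) (*-cauchy {seq x} {seq y} (cauchy x) (cauchy y))

------------------------------------------------------------------------
-- Euclidean space

Point : ℕ → Set
Point d = Vector ℝ d

_≈ᴾ_ : ∀ {d} → Point d → Point d → Set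
x ≈ᴾ y = ∀ i → x i ≈ℝ y i

_⟶_ : ∀ {d} → Point d → Point d → Point d
(x ⟶ y) i = y i -ℝ x i

along : ∀ {d} → Point d → Point d → ℝ → Point d
along x y t i = x i +ℝ t *ℝ (x ⟶ y) i

infixl 7 _·_

_·_ : ∀ {d} → Point d → Point d → ℝ
v · w = foldr _+ℝ_ 0ℝ (λ i → v i *ℝ w i)

unit : ∀ {d} → Fin d → Point d
unit i j = if does (i ≟F j) then 1ℝ else 0ℝ

-- The angle between v and the line spanned by w (both nonzero) is at most
-- 45°:  |v · w| / (|v| |w|) ≥ cos 45° = 1/√2, squared.
AngleToLine≤45° : ∀ {d} → Point d → Point d → Set
AngleToLine≤45° v w = (v · v) *ℝ (w · w) ≤ℝ fromℕ 2 *ℝ ((v · w) *ℝ (v · w))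

------------------------------------------------------------------------
-- Unit hypercubes and their facets

-- The vector a stands for the hypercube ∏ᵢ [aᵢ , aᵢ + 1] inside [0 , n]ᵈ.
Cube : ℕ → ℕ → Set
Cube d n = Vec (Fin n) d

corner : ∀ {d n} → Cube d n → Fin d → ℕ
corner Q i = toℕ (lookup Q i)

InUnitCubeAt : ∀ {d} → (Fin d → ℕ) → Point d → Set
InUnitCubeAt a x = ∀ i → fromℕ (a i) ≤ℝ x i × x i ≤ℝ fromℕ (ℕ.suc (a i))

origin : ∀ {d} → Fin d → ℕ
origin _ = 0

IsObserver : ∀ {d n} → Cube d n → Set
IsObserver Q = ∀ i → corner Q i ≡ origin i

-- (i , false) and (i , true) are the facets on which the i-th coordinate is
-- least, respectively greatest.
Facet : ℕ → Set
Facet d = Fin d × Bool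

normal : ∀ {d} → Facet d → Point d
normal (i , _) = unit i

OnFacet : ∀ {d n} → Cube d n → Facet d → Point d → Set
OnFacet Q (i , side) x =
  InUnitCubeAt (corner Q) x ×
  x i ≈ℝ fromℕ (if side then ℕ.suc (corner Q i) else corner Q i)

------------------------------------------------------------------------
-- Visibility

-- The hypercube Q blocks, at the angle 45°, the segment from x to y at a
-- point other than y.
BlocksBefore : ∀ {d n} → Cube d n → Point d → Point d → Set
BlocksBefore Q x y =
  ∃[ F ] ∃[ t ] 0ℝ ≤ℝ t × t <ℝ 1ℝ ×
    OnFacet Q F (along x y t) × AngleToLine≤45° (x ⟶ y) (normal F)

Visible : ∀ {d n} → Pred (Cube d n) 0ℓ → Cube d n → Set
Visible {d} O Q =
  ∃[ x ] ∃[ y ] ∃[ F ]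
    InUnitCubeAt (origin {d}) x ×
    OnFacet Q F y ×
    ¬ (x ≈ᴾ y) ×
    AngleToLine≤45° (x ⟶ y) (normal F) ×
    (∀ Q′ → Q′ ∈ O → Q′ ≢ Q → ¬ BlocksBefore Q′ x y)

------------------------------------------------------------------------
-- The bound

-- N ≤ C n^(d - 1/d) log₂ n as an inequality of real numbers: it says that
-- N ≤ C n^(d - 1/d) (p / q) for every rational p / q ≥ log₂ n, where
-- log₂ n ≤ p / q means n ^ q ≤ 2 ^ p, and raising the inequality to the d-th
-- power removes the fractional exponent, since d (d - 1/d) = d² - 1.  Taking
-- C in ℕ and the logarithm to base 2 only affects the constant.
AtMost-C·n^[d-1/d]·log-n : (d C n N : ℕ) → Set
AtMost-C·n^[d-1/d]·log-n d C n N =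
  ∀ p q → 0 ℕ.< q → n ^ q ℕ.≤ 2 ^ p →
    (N ℕ.* q) ^ d ℕ.≤ (C ℕ.* p) ^ d ℕ.* n ^ (d ℕ.* d ℕ.∸ 1)

-- The number of elements satisfying P is bounded as in B, stated without
-- assuming that P is decidable: B holds of the length of every duplicate-free
-- list of such elements.  (Meaningful for downward closed B.)
NumberOf_Satisfies_ : {A : Set} → Pred A 0ℓ → Pred ℕ 0ℓ → Set
NumberOf P Satisfies B = ∀ xs → Unique xs → All P xs → B (length xs)

{-# OPTIONS --safe #-}

module Submission where

open import Defs

-- Classes are built so that a high cube is hidden by the lowest cube of its kind. For heights h
-- with N/2 ≤ h + 1 < N, N a power of 2, division gives co · N = b (h + 1) + r with a quantized
-- direction b. For equal b the drift of the ray past a lower cube depends mainly on r - r′, which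
-- must grow with the rise H, but by far less than a cell. Fixing `diag`, which ties r to 80 times
-- the height up to N / L, enforces this once H ≥ N / (40 L), at the price of about L^m classes,
-- where m = d - 1. The obstacle is a smaller rise, where N / L swamps 80 H and nothing need be
-- hidden. Then, however, r and r′ differ by at most 3N / L, so H b is nearly a multiple of N in
-- every coordinate. For each H this leaves O(n / L) directions per coordinate, and H itself has O(n
-- / L) values: O((n / L)^d) cubes per class. The lowest cubes have one height per direction vector,
-- O(n^m) in all. Both are O(n^m) when L is the integer part of n^(1/d), and the product with L^m
-- has exponent d - 1/d. The logarithm counts the dyadic ranges of heights.

module Counting where

  open import Data.Bool using (Bool; true; false; if_then_else_)
  open import Data.Fin as F using (Fin; toℕ; combine; join; funToFin; finToFun)
  import Data.Fin.Properties as F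
  open import Data.Nat
  open import Data.Nat.DivMod
  open import Data.Nat.Induction using (<-rec)
  open import Data.Nat.Properties
  open import Data.Nat.Tactic.RingSolver using (solve-∀)
  open import Data.Product
  open import Data.Sum using (_⊎_; inj₁; inj₂)
  open import Data.Sum.Properties using (inj₁-injective; inj₂-injective)
  open import Relation.Binary.PropositionalEquality
  open import Relation.Nullary
  open import Relation.Nullary.Decidable using (_×-dec_)

  -- When a lower cube hides a higher one: integer inequalities

  Clears : (u v z h : ℕ) → Set
  Clears u v z h = u + z ≤ v × 8 * (v + z) ≤ 8 * u + h

  -- For h = h′ + H and a = a′ + W, (h′ a − h a′) / h is the coordinate relative to a′, at height h′, of the ray from
  -- the origin to (a , h).  The term W + H + 1 absorbs the freedom of the end points within their unit cubes.  The
  -- Boolean tells whether the ray ends in the low (false) or high (true) half of its cell.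
  Passes : Bool → (H W h a h′ a′ : ℕ) → Set
  Passes false H W h a h′ a′ = Clears (h * a′) (h′ * a) (W + H + 1) h
  Passes true  H W h a h′ a′ = Clears (h′ * a) (h * a′) (W + H + 1) h

  -- A certificate for linear arithmetic: `A ≤ B` is a sum of multiples of hypotheses, assembled
  -- with `_⊞_` and `_⊠_`, and k is the slack. Only a ring identity remains.
  lin : ∀ {A B} p q k → A ≤ B → p + B + k ≡ q + A → p ≤ q
  lin {A} {B} p q k A≤B eq = +-cancelʳ-≤ B p q (begin
    p + B      ≤⟨ m≤m+n (p + B) k ⟩
    p + B + k  ≡⟨ eq ⟩
    q + A      ≤⟨ +-monoʳ-≤ q A≤B ⟩
    q + B      ∎)
    where open ≤-Reasoning

  infixl 6 _⊞_
  _⊞_ : ∀ {a b c d} → a ≤ b → c ≤ d → a + c ≤ b + d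
  _⊞_ = +-mono-≤

  infixr 7 _⊠_
  _⊠_ : ∀ {a b} c → a ≤ b → c * a ≤ c * b
  c ⊠ p = *-monoʳ-≤ c p

  module _ (h H h′ a a′ W N b r r′ : ℕ) .{{_ : NonZero N}} (h≡ : h ≡ h′ + H)
    (aN : a * N ≡ r + b * suc h) (a′N : a′ * N ≡ r′ + b * suc h′)
    (1≤H : 1 ≤ H) (b≤ : b ≤ 6 * N) (W≤ : W ≤ 6 * H) (r≤N : r ≤ N) (N≤ : 15 * N ≤ 40 * h) (h≤N : h ≤ N)
    (H≤ : 2000 * H ≤ h)
    where

    private
      u v : ℕ
      u = h * (r′ + b * suc h′)
      v = h′ * (r + b * suc h)

      Nu : N * (h * a′) ≡ u
      Nu = trans (eq N h a′) (cong (h *_) a′N)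
        where
        eq : ∀ N h a → N * (h * a) ≡ h * (a * N)
        eq = solve-∀

      Nv : N * (h′ * a) ≡ v
      Nv = trans (eq N h′ a) (cong (h′ *_) aN)
        where
        eq : ∀ N h a → N * (h * a) ≡ h * (a * N)
        eq = solve-∀

      scale : ∀ {p q P Q} → N * p ≡ P → N * q ≡ Q → P + N * (W + H + 1) ≤ Q → 8 * (Q + N * (W + H + 1)) ≤ 8 * P
          + N * h →
              Clears p q (W + H + 1) h
      scale {p} {q} refl refl f g =
        *-cancelˡ-≤ N (subst (_≤ N * q) (sym (*-distribˡ-+ N p (W + H + 1))) f) ,
        *-cancelˡ-≤ N (subst₂ _≤_ (e₁ N q (W + H + 1)) (e₂ N p h) g)
        where
        e₁ : ∀ N q z → 8 * (N * q + N * z) ≡ N * (8 * (q + z))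
        e₁ = solve-∀
        e₂ : ∀ N p h → 8 * (N * p) + N * h ≡ N * (8 * p + h)
        e₂ = solve-∀

    -- Multiplied by N, the drift h′a - ha′ is h(r - r′) - H(r + b). Here H(r + b) ≤ 7NH and N(W + H
    -- + 1) ≤ 8NH, together at most 15NH ≤ 40hH: a gap of 40H pays for them. From above, 8 · (120 +
    -- 8) NH stays below 2000NH ≤ Nh.
    passes-low : suc (r′ + 40 * H) ≤ r → r ≤ r′ + 120 * H → Passes false H W h a h′ a′
    passes-low f₁ f₂ = scale Nu Nv
      (lin (u + N * (W + H + 1)) v h
        (h ⊠ f₁ ⊞ H ⊠ r≤N ⊞ H ⊠ b≤ ⊞ N ⊠ W≤ ⊞ N ⊠ 1≤H ⊞ H ⊠ N≤) (e₁ h h≡))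
      (lin (8 * (v + N * (W + H + 1))) (8 * u + N * h) (8 * (b * H) + 8 * (H * r) + 976 * (N * H))
        (8 ⊠ (h ⊠ f₂ ⊞ (120 * H) ⊠ h≤N ⊞ N ⊠ W≤ ⊞ N ⊠ 1≤H) ⊞ N ⊠ H≤) (e₂ h h≡))
      where
      e₁ : ∀ h → h ≡ h′ + H → (h * (r′ + b * suc h′) + N * (W + H + 1)) + (h * r + H * N + H * (6 * N)
          + N * (6 * H) + N * H + H * (40 * h)) + h ≡
           h′ * (r + b * suc h) + (h * suc (r′ + 40 * H) + H * r + H * b + N * W + N * 1 + H * (15 * N))
      e₁ _ refl = eq h′ H W N b r r′
        where
        eq : ∀ h′ H W N b r r′ → ((h′ + H) * (r′ + b * suc h′) + N * (W + H + 1)) + ((h′ + H) * r + H * N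
            + H * (6 * N) + N * (6 * H) + N * H + H * (40 * (h′ + H))) + (h′ + H) ≡
           h′ * (r + b * suc (h′ + H)) + ((h′ + H) * suc (r′ + 40 * H) + H * r + H * b + N * W + N * 1
               + H * (15 * N))
        eq = solve-∀
      e₂ : ∀ h → h ≡ h′ + H → 8 * (h′ * (r + b * suc h) + N * (W + H + 1))
          + (8 * (h * (r′ + 120 * H) + (120 * H) * N + N * (6 * H) + N * H) + N * h) + (8 * (b * H) + 8 * (H * r)
          + 976 * (N * H)) ≡
           8 * (h * (r′ + b * suc h′)) + N * h + (8 * (h * r + (120 * H) * h + N * W + N * 1) + N * (2000 * H))
      e₂ _ refl = eq h′ H W N b r r′
        where
        eq : ∀ h′ H W N b r r′ → 8 * (h′ * (r + b * suc (h′ + H)) + N * (W + H + 1))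
            + (8 * ((h′ + H) * (r′ + 120 * H) + (120 * H) * N + N * (6 * H) + N * H) + N * (h′ + H))
            + (8 * (b * H) + 8 * (H * r) + 976 * (N * H)) ≡
           8 * ((h′ + H) * (r′ + b * suc h′)) + N * (h′ + H) + (8 * ((h′ + H) * r + (120 * H) * (h′ + H) + N * W
               + N * 1) + N * (2000 * H))
        eq = solve-∀

    -- The drift has the opposite sign, so H(r + b) now helps the lower bound and burdens the upper
    -- one: 8 · (120 + 7 + 8) NH = 1080NH ≤ 2000NH.
    passes-high : suc (r + 40 * H) ≤ r′ → r′ ≤ r + 120 * H → Passes true H W h a h′ a′
    passes-high f₁ f₂ = scale Nv Nu
      (lin (v + N * (W + H + 1)) u (b * H + h + H * r + 7 * (N * H))
        (h ⊠ f₁ ⊞ N ⊠ W≤ ⊞ N ⊠ 1≤H ⊞ H ⊠ N≤) (e₁ h h≡))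
      (lin (8 * (u + N * (W + H + 1))) (8 * v + N * h) (920 * (N * H))
        (8 ⊠ (h ⊠ f₂ ⊞ (120 * H) ⊠ h≤N ⊞ H ⊠ r≤N ⊞ H ⊠ b≤ ⊞ N ⊠ W≤ ⊞ N ⊠ 1≤H) ⊞ N ⊠ H≤) (e₂ h h≡))
      where
      e₁ : ∀ h → h ≡ h′ + H → (h′ * (r + b * suc h) + N * (W + H + 1)) + (h * r′ + N * (6 * H) + N * H
          + H * (40 * h)) + (b * H + h + H * r + 7 * (N * H)) ≡
           h * (r′ + b * suc h′) + (h * suc (r + 40 * H) + N * W + N * 1 + H * (15 * N))
      e₁ _ refl = eq h′ H W N b r r′
        where
        eq : ∀ h′ H W N b r r′ → (h′ * (r + b * suc (h′ + H)) + N * (W + H + 1)) + ((h′ + H) * r′ + N * (6 * H)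
            + N * H + H * (40 * (h′ + H))) + (b * H + (h′ + H) + H * r + 7 * (N * H)) ≡
           (h′ + H) * (r′ + b * suc h′) + ((h′ + H) * suc (r + 40 * H) + N * W + N * 1 + H * (15 * N))
        eq = solve-∀
      e₂ : ∀ h → h ≡ h′ + H → 8 * (h * (r′ + b * suc h′) + N * (W + H + 1))
          + (8 * (h * (r + 120 * H) + (120 * H) * N + H * N + H * (6 * N) + N * (6 * H) + N * H) + N * h)
          + 920 * (N * H) ≡
           8 * (h′ * (r + b * suc h)) + N * h + (8 * (h * r′ + (120 * H) * h + H * r + H * b + N * W + N * 1)
               + N * (2000 * H))
      e₂ _ refl = eq h′ H W N b r r′
        where
        eq : ∀ h′ H W N b r r′ → 8 * ((h′ + H) * (r′ + b * suc h′) + N * (W + H + 1))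
            + (8 * ((h′ + H) * (r + 120 * H) + (120 * H) * N + H * N + H * (6 * N) + N * (6 * H) + N * H)
            + N * (h′ + H)) + 920 * (N * H) ≡
           8 * (h′ * (r + b * suc (h′ + H))) + N * (h′ + H) + (8 * ((h′ + H) * r′ + (120 * H) * (h′ + H) + H * r
               + H * b + N * W + N * 1) + N * (2000 * H))
        eq = solve-∀

  -- Two cubes of one class with the same quantized direction

  /-≡⇒< : ∀ x y N .{{_ : NonZero N}} → x / N ≡ y / N → x < y + N
  /-≡⇒< x y N eq = begin-strict
    x                      ≡⟨ m≡m%n+[m/n]*n x N ⟩
    x % N + (x / N) * N    ≡⟨ cong (λ q → x % N + q * N) eq ⟩
    x % N + (y / N) * N    <⟨ +-mono-<-≤ (m%n<n x N) (m/n*n≤m y N) ⟩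
    N + y                  ≡⟨ +-comm N y ⟩
    y + N                  ∎
    where open ≤-Reasoning

  %-unique : ∀ x y G .{{_ : NonZero G}} → x % G ≡ y % G → x ≤ y → y < x + G → x ≡ y
  %-unique x y G eq x≤y y<x+G = begin-equality
    x                    ≡⟨ m≡m%n+[m/n]*n x G ⟩
    x % G + (x / G) * G  ≡⟨ cong₂ (λ p q → p + q * G) eq q≡ ⟩
    y % G + (y / G) * G  ≡⟨ m≡m%n+[m/n]*n y G ⟨
    y                    ∎
    where
    open ≤-Reasoning
    y/G<1+x/G : y / G < suc (x / G)
    y/G<1+x/G = *-cancelʳ-< G (y / G) (suc (x / G)) (+-cancelˡ-< (y % G) _ _ (begin-strict
      y % G + (y / G) * G         ≡⟨ m≡m%n+[m/n]*n y G ⟨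
      y                           <⟨ y<x+G ⟩
      x + G                       ≡⟨ cong (_+ G) (m≡m%n+[m/n]*n x G) ⟩
      x % G + (x / G) * G + G     ≡⟨ cong (λ p → p + (x / G) * G + G) eq ⟩
      y % G + (x / G) * G + G     ≡⟨ e (y % G) (x / G) G ⟩
      y % G + suc (x / G) * G     ∎))
      where
      e : ∀ p q G → p + q * G + G ≡ p + suc q * G
      e = solve-∀
    q≡ : x / G ≡ y / G
    q≡ = ≤-antisym (/-monoˡ-≤ G x≤y) (≤-pred y/G<1+x/G)

  -- The remainder is reversed for the high half, so that in both halves hiding amounts to an
  -- increase of this quantity by 40H to 120H.
  position : Bool → (N r : ℕ) → ℕ
  position σ N r = if σ then N ∸ r else r

  drop-4000 : ∀ h H N → 4000 * H < N → N ≤ 2 * suc h → 2000 * H ≤ h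
  drop-4000 h H N 4000H<N N≤2g = ≤-pred (*-cancelˡ-< 2 (2000 * H) (suc h) (<-≤-trans (subst (_< N) (e H) 4000H<N)
      N≤2g))
    where
    e : ∀ H → 4000 * H ≡ 2 * (2000 * H)
    e = solve-∀

  -- Both cubes lie close to the line of slope b / N, with r / N and r′ / N < 1 their distances
  -- beyond it. Heights enter as h + 1, so that height 0 can be divided by.
  module Pair (N L h h′ H a a′ b r r′ : ℕ) .{{_ : NonZero N}} .{{_ : NonZero L}} (σ : Bool) (h≡ : h ≡ h′ + H)
      (1≤H : 1 ≤ H)
    (aN : a * N ≡ r + b * suc h) (a′N : a′ * N ≡ r′ + b * suc h′)
    (r<g : r < suc h) (r′<g′ : r′ < suc h′) (g<N : suc h < N) (N≤2g : N ≤ 2 * suc h)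
    (b≤ : b ≤ 6 * N) (4000H<N : 4000 * H < N)
    (fold : (L * (position σ N r + 80 * (N ∸ suc h))) / N ≡ (L * (position σ N r′ + 80 * (N ∸ suc h′))) / N)
    where

    g′≤g : suc h′ ≤ suc h
    g′≤g = s≤s (subst (h′ ≤_) (sym h≡) (m≤m+n h′ H))

    r<N : r < N
    r<N = <-trans r<g g<N

    r′<N : r′ < N
    r′<N = <-trans (<-≤-trans r′<g′ g′≤g) g<N

    -- The line does not descend, and falling back by a whole cell would require a remainder r′ of
    -- at least N.
    a′≤a : a′ ≤ a
    a′≤a = ≮⇒≥ λ a<a′ → <⇒≱ r′<N (lin N r′ (r + b * H) (≤-trans (*-monoˡ-≤ N a<a′) (≤-reflexive a′N)) (e h h≡ aN))
      where
      e : ∀ h → h ≡ h′ + H → a * N ≡ r + b * suc h → N + (r′ + b * suc h′) + (r + b * H) ≡ r′ + (N + a * N)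
      e _ refl aN = trans (eq N r′ b h′ r H) (cong (λ z → r′ + (N + z)) (sym aN))
        where
        eq : ∀ N r′ b h′ r H → N + (r′ + b * suc h′) + (r + b * H) ≡ r′ + (N + (r + b * suc (h′ + H)))
        eq = solve-∀

    W : ℕ
    W = a ∸ a′

    a≡ : a ≡ a′ + W
    a≡ = sym (m+[n∸m]≡n a′≤a)

    -- The difference of the two division identities. It shows that H b misses the multiple W N by
    -- exactly r′ - r, the fact behind the saving for small rises.
    WN : W * N + r′ ≡ H * b + r
    WN = +-cancelʳ-≡ (b * suc h′) (W * N + r′) (H * b + r) (begin
      W * N + r′ + b * suc h′    ≡⟨ +-assoc (W * N) r′ (b * suc h′) ⟩
      W * N + (r′ + b * suc h′)  ≡⟨ cong (W * N +_) a′N ⟨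
      W * N + a′ * N             ≡⟨ *-distribʳ-+ N W a′ ⟨
      (W + a′) * N               ≡⟨ cong (_* N) (trans (+-comm W a′) (sym a≡)) ⟩
      a * N                      ≡⟨ aN ⟩
      r + b * suc h              ≡⟨ cong (λ z → r + b * suc z) h≡ ⟩
      r + b * suc (h′ + H)       ≡⟨ e r b h′ H ⟩
      H * b + r + b * suc h′     ∎)
      where
      open ≡-Reasoning
      e : ∀ r b h′ H → r + b * suc (h′ + H) ≡ H * b + r + b * suc h′
      e = solve-∀

    W≤6H : W ≤ 6 * H
    W≤6H = ≤-pred (*-cancelʳ-< N W (suc (6 * H)) (begin-strict
      W * N              ≤⟨ m≤m+n (W * N) r′ ⟩
      W * N + r′         ≡⟨ WN ⟩
      H * b + r          <⟨ +-mono-≤-< (H ⊠ b≤) r<N ⟩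
      H * (6 * N) + N    ≡⟨ e H N ⟩
      suc (6 * H) * N    ∎))
      where
      open ≤-Reasoning
      e : ∀ H N → H * (6 * N) + N ≡ suc (6 * H) * N
      e = solve-∀

    D s s′ : ℕ
    D = N ∸ suc h
    s = position σ N r
    s′ = position σ N r′

    N∸g′ : N ∸ suc h′ ≡ D + H
    N∸g′ = +-cancelʳ-≡ (suc h′) (N ∸ suc h′) (D + H) (begin
      N ∸ suc h′ + suc h′  ≡⟨ m∸n+n≡m (≤-trans g′≤g (<⇒≤ g<N)) ⟩
      N                    ≡⟨ m∸n+n≡m (<⇒≤ g<N) ⟨
      D + suc h            ≡⟨ cong (λ z → D + suc z) h≡ ⟩
      D + suc (h′ + H)     ≡⟨ e D h′ H ⟩
      D + H + suc h′       ∎)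
      where
      open ≡-Reasoning
      e : ∀ D h′ H → D + suc (h′ + H) ≡ D + H + suc h′
      e = solve-∀

    fold′ : (L * (s + 80 * D)) / N ≡ (L * (s′ + 80 * (D + H))) / N
    fold′ = subst (λ z → (L * (s + 80 * D)) / N ≡ (L * (s′ + 80 * z)) / N) N∸g′ fold

    fold₁ : suc (L * (s + 80 * D)) ≤ L * (s′ + 80 * (D + H)) + N
    fold₁ = /-≡⇒< (L * (s + 80 * D)) (L * (s′ + 80 * (D + H))) N fold′

    fold₂ : suc (L * (s′ + 80 * (D + H))) ≤ L * (s + 80 * D) + N
    fold₂ = /-≡⇒< (L * (s′ + 80 * (D + H))) (L * (s + 80 * D)) N (sym fold′)

    -- Equal diagonals leave an error below N after scaling by L, and the skew 80HL is below 2N.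
    short : suc (40 * (H * L)) ≤ N → L * s ≤ L * s′ + 3 * N × L * s′ ≤ L * s + 3 * N
    short small = lin (L * s) (L * s′ + 3 * N) 3 (fold₁ ⊞ 2 ⊠ small) (e₁ L s s′ D H N)
                , lin (L * s′) (L * s + 3 * N) (1 + 80 * (H * L) + 2 * N) fold₂ (e₂ L s s′ D H N)
      where
      e₁ : ∀ L s s′ D H N → L * s + (L * (s′ + 80 * (D + H)) + N + 2 * N) + 3 ≡ L * s′ + 3 * N
          + (suc (L * (s + 80 * D)) + 2 * suc (40 * (H * L)))
      e₁ = solve-∀
      e₂ : ∀ L s s′ D H N → L * s′ + (L * (s + 80 * D) + N) + (1 + 80 * (H * L) + 2 * N) ≡ L * s + 3 * N
          + suc (L * (s′ + 80 * (D + H)))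
      e₂ = solve-∀

    long : N ≤ 40 * (H * L) → suc (s′ + 40 * H) ≤ s × s ≤ s′ + 120 * H
    long large = *-cancelˡ-< L (s′ + 40 * H) s (lin (suc (L * (s′ + 40 * H))) (L * s) 0 (fold₂ ⊞ large)
        (e₁ L s s′ D H N))
               , <⇒≤ (*-cancelˡ-< L s (s′ + 120 * H) (lin (suc (L * s)) (L * (s′ + 120 * H)) 0 (fold₁ ⊞ large)
                   (e₂ L s s′ D H N)))
      where
      e₁ : ∀ L s s′ D H N → suc (L * (s′ + 40 * H)) + (L * (s + 80 * D) + N + 40 * (H * L)) + 0 ≡
          L * s + (suc (L * (s′ + 80 * (D + H))) + N)
      e₁ = solve-∀
      e₂ : ∀ L s s′ D H N → suc (L * s) + (L * (s′ + 80 * (D + H)) + N + 40 * (H * L)) + 0 ≡ L * (s′ + 120 * H)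
          + (suc (L * (s + 80 * D)) + N)
      e₂ = solve-∀

    2000H≤h : 2000 * H ≤ h
    2000H≤h = drop-4000 h H N 4000H<N N≤2g

    15N≤40h : 15 * N ≤ 40 * h
    15N≤40h = lin (15 * N) (40 * h) 0 (15 ⊠ N≤2g ⊞ 10 ⊠ 3≤h) (e N h)
      where
      3≤h : 3 ≤ h
      3≤h = ≤-trans (≤-trans (m≤m+n 3 1997) (2000 ⊠ 1≤H)) 2000H≤h
      e : ∀ N h → 15 * N + (15 * (2 * suc h) + 10 * h) + 0 ≡ 40 * h + (15 * N + 10 * 3)
      e = solve-∀

    p+r : N ∸ r + r ≡ N ∸ r′ + r′
    p+r = trans (m∸n+n≡m (<⇒≤ r<N)) (sym (m∸n+n≡m (<⇒≤ r′<N)))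

    passes : N ≤ 40 * (H * L) → Passes σ H W h a h′ a′
    passes large = go σ (long large)
      where
      go : ∀ σ → suc (position σ N r′ + 40 * H) ≤ position σ N r × position σ N r ≤ position σ N r′ + 120 * H →
          Passes σ H W h a h′ a′
      go false (f₁ , f₂) = passes-low h H h′ a a′ W N b r r′ h≡ aN a′N 1≤H b≤ W≤6H (<⇒≤ r<N) 15N≤40h
          (≤-trans (n≤1+n h) (<⇒≤ g<N)) 2000H≤h f₁ f₂
      go true (f₁ , f₂) = passes-high h H h′ a a′ W N b r r′ h≡ aN a′N 1≤H b≤ W≤6H (<⇒≤ r<N) 15N≤40h
          (≤-trans (n≤1+n h) (<⇒≤ g<N)) 2000H≤h
        (lin (suc (r + 40 * H)) r′ 0 (f₁ ⊞ ≤-reflexive p+r) (e₁ r r′ (N ∸ r) (N ∸ r′) H))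
        (lin r′ (r + 120 * H) 0 (f₂ ⊞ ≤-reflexive (sym p+r)) (e₂ r r′ (N ∸ r) (N ∸ r′) H))
        where
        e₁ : ∀ r r′ p p′ H → suc (r + 40 * H) + (p + (p′ + r′)) + 0 ≡ r′ + (suc (p′ + 40 * H) + (p + r))
        e₁ = solve-∀
        e₂ : ∀ r r′ p p′ H → r′ + (p′ + 120 * H + (p + r)) + 0 ≡ r + 120 * H + (p + (p′ + r′))
        e₂ = solve-∀

    close : suc (40 * (H * L)) ≤ N → L * r ≤ L * r′ + 3 * N × L * r′ ≤ L * r + 3 * N
    close small = go σ (short small)
      where
      go : ∀ σ → L * position σ N r ≤ L * position σ N r′ + 3 * N × L * position σ N r′ ≤ L * position σ N r
          + 3 * N →
           L * r ≤ L * r′ + 3 * N × L * r′ ≤ L * r + 3 * N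
      go false h = h
      go true (f₁ , f₂) = lin (L * r) (L * r′ + 3 * N) 0 (f₂ ⊞ L ⊠ ≤-reflexive p+r) (e L r r′ (N ∸ r) (N ∸ r′) N)
                        , lin (L * r′) (L * r + 3 * N) 0 (f₁ ⊞ L ⊠ ≤-reflexive (sym p+r))
                            (e L r′ r (N ∸ r′) (N ∸ r) N)
        where
        e : ∀ L r r′ p p′ N → L * r + (L * p + 3 * N + L * (p′ + r′)) + 0 ≡ L * r′ + 3 * N
            + (L * p′ + L * (p + r))
        e = solve-∀

  -- Subtraction cancels W N and leaves LH(b₂ - b) = L(r - r′) + L(r₂′ - r₂) ≤ 6N < LHG. Thus b₂
  -- lies in a window of length G above b, where the residue modulo G identifies it.
  same-shift : ∀ N L H W b r r′ b₂ r₂ r₂′ G .{{_ : NonZero G}} → W * N + r′ ≡ H * b + r → W * N + r₂′ ≡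
      H * b₂ + r₂ →
    L * r ≤ L * r′ + 3 * N → L * r₂′ ≤ L * r₂ + 3 * N → 6 * N < L * H * G → b ≤ b₂ → b % G ≡ b₂ % G → b ≡ b₂
  same-shift N L H W b r r′ b₂ r₂ r₂′ G eq eq₂ c c₂ 6N< b≤b₂ b≡b₂%G =
    %-unique b b₂ G b≡b₂%G b≤b₂ (*-cancelˡ-< (L * H) b₂ (b + G) (lin (suc (L * H * b₂)) (L * H * (b + G)) 0
      (c ⊞ c₂ ⊞ 6N< ⊞ L ⊠ ≤-reflexive (cong₂ _+_ eq (sym eq₂))) (e N L H W b r r′ b₂ r₂ r₂′ G)))
    where
    e : ∀ N L H W b r r′ b₂ r₂ r₂′ G → suc (L * H * b₂) + ((L * r′ + 3 * N) + (L * r₂ + 3 * N) + L * H * G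
        + L * (H * b + r + (W * N + r₂′))) + 0 ≡
        L * H * (b + G) + (L * r + L * r₂′ + suc (6 * N) + L * (W * N + r′ + (H * b₂ + r₂)))
    e = solve-∀

  -- Finite encodings, dyadic levels and short codes for directions

  mod-injective : ∀ {x y} M .{{_ : NonZero M}} → x < M → y < M → x mod M ≡ y mod M → x ≡ y
  mod-injective {x} {y} M x<M y<M eq = begin
    x              ≡⟨ m<n⇒m%n≡m x<M ⟨
    x % M          ≡⟨ F.toℕ-fromℕ< (m%n<n x M) ⟨
    toℕ (x mod M)  ≡⟨ cong toℕ eq ⟩
    toℕ (y mod M)  ≡⟨ F.toℕ-fromℕ< (m%n<n y M) ⟩
    y % M          ≡⟨ m<n⇒m%n≡m y<M ⟩
    y              ∎
    where open ≡-Reasoning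

  funToFin-injective : ∀ {m k} (f g : Fin m → Fin k) → funToFin f ≡ funToFin g → ∀ i → f i ≡ g i
  funToFin-injective f g eq i =
    trans (sym (F.finToFun-funToFin f i)) (trans (cong (λ c → finToFun c i) eq) (F.finToFun-funToFin g i))

  join-injective : ∀ {k l} (x y : Fin k ⊎ Fin l) → join k l x ≡ join k l y → x ≡ y
  join-injective {k} {l} x y eq =
    trans (sym (F.splitAt-join k l x)) (trans (cong (F.splitAt k) eq) (F.splitAt-join k l y))

  -- Strong induction on the height: any lower index with the same key takes over, and the search
  -- for one is decidable because the indices are finite.
  least : ∀ {s K} (key : Fin s → Fin K) (ht : Fin s → ℕ) (j : Fin s) →
    ∃[ j′ ] key j′ ≡ key j × (∀ i → key i ≡ key j → ht j′ ≤ ht i)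
  least {s} {K} key ht j = <-rec P step (ht j) j refl
    where
    P : ℕ → Set
    P h = ∀ j → ht j ≡ h → ∃[ j′ ] key j′ ≡ key j × (∀ i → key i ≡ key j → ht j′ ≤ ht i)
    step : ∀ h → (∀ {h′} → h′ < h → P h′) → P h
    step h rec j refl with F.any? (λ i → (key i F.≟ key j) ×-dec (ht i <? ht j))
    ... | yes (i , same , lower) =
            let (j′ , same′ , min) = rec lower i refl
            in j′ , trans same′ same , λ i′ eq → min i′ (trans eq (sym same))
    ... | no none = j , refl , λ i eq → ≮⇒≥ λ lower → none (i , eq , lower)

  log₂-bracket : ∀ h → ∃[ k ] 2 ^ k ≤ suc h × suc h < 2 ^ suc k
  log₂-bracket zero = 0 , ≤-refl , ≤-refl
  log₂-bracket (suc h) with log₂-bracket h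
  ... | k , lo , hi with suc (suc h) <? 2 ^ suc k
  ... | yes hi′ = k , ≤-trans lo (n≤1+n (suc h)) , hi′
  ... | no ¬hi′ = suc k , ≮⇒≥ ¬hi′ , <-≤-trans (s≤s hi) (lin (suc (2 ^ suc k)) (2 ^ suc (suc k)) 0
      (m^n>0 2 (suc k)) (e (2 ^ suc k)))
    where
    e : ∀ x → suc x + x + 0 ≡ 2 * x + 1
    e = solve-∀

  pair-injective : ∀ G w x w′ x′ .{{_ : NonZero G}} → x < G → x′ < G → w * G + x ≡ w′ * G + x′ → w ≡ w′ × x ≡ x′
  pair-injective G w x w′ x′ x<G x′<G eq = *-cancelʳ-≡ w w′ G (+-cancelʳ-≡ x (w * G) (w′ * G)
      (trans eq (cong (w′ * G +_) (sym x≡)))) , x≡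
    where
    rem : ∀ w x → x < G → (w * G + x) % G ≡ x
    rem w x x<G = trans (cong (_% G) (+-comm (w * G) x)) (trans ([m+kn]%n≡m%n x w G) (m<n⇒m%n≡m x<G))
    x≡ : x ≡ x′
    x≡ = trans (sym (rem w x x<G)) (trans (cong (_% G) eq) (rem w′ x′ x′<G))

  -- Says that H b lies within 3N / L of W N. The remainders matter only through their closeness.
  record Shift (N L H b W : ℕ) : Set where
    field
      r r′ : ℕ
      WN   : W * N + r′ ≡ H * b + r
      W≤6H : W ≤ 6 * H
      r≤   : L * r ≤ L * r′ + 3 * N
      r′≤  : L * r′ ≤ L * r + 3 * N

  module Code (L₀ N H₀ : ℕ) where
    L H G : ℕ
    L = suc L₀
    H = suc H₀
    -- The least integer above 6N / (LH), the width of the window for b once H and W are known.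
    G = suc ((6 * N) / (suc L₀ * suc H₀))

    code : (b W : ℕ) → ℕ
    code b W = W * G + b % G

    6N<LHG : 6 * N < L * H * G
    6N<LHG = begin-strict
      6 * N                                              ≡⟨ m≡m%n+[m/n]*n (6 * N) (L * H) ⟩
      (6 * N) % (L * H) + ((6 * N) / (L * H)) * (L * H)  <⟨ +-monoˡ-< _ (m%n<n (6 * N) (L * H)) ⟩
      L * H + ((6 * N) / (L * H)) * (L * H)              ≡⟨ e (L * H) ((6 * N) / (L * H)) ⟩
      L * H * G                                          ∎
      where
      open ≤-Reasoning
      e : ∀ x q → x + q * x ≡ x * suc q
      e = solve-∀

    LHG≤ : L * H * G ≤ L * H + 6 * N
    LHG≤ = ≤-trans (≤-reflexive (e (L * H) ((6 * N) / (L * H)))) (+-monoʳ-≤ (L * H) (m/n*n≤m (6 * N) (L * H)))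
      where
      e : ∀ x q → x * suc q ≡ x + q * x
      e = solve-∀

    -- There are at most 6H + 1 ≤ 7H values of W with G residues each, and 7LHG ≤ 7(LH + 6N) ≤ 49N.
    code-bound : ∀ {b W} → W ≤ 6 * H → L * H ≤ N → L * code b W ≤ 49 * N
    code-bound {b} {W} W≤ LH≤N = lin (L * (W * G + b % G)) (49 * N) 0
      ((L * G) ⊠ W≤ ⊞ L ⊠ (<⇒≤ (m%n<n b G)) ⊞ 7 ⊠ LHG≤ ⊞ 7 ⊠ LH≤N ⊞ (L * G) ⊠ s≤s z≤n) (e L W G (b % G) H₀ N)
      where
      e : ∀ L W G x H₀ N → L * (W * G + x) + (L * G * (6 * suc H₀) + L * G + 7 * (L * suc H₀ + 6 * N) + 7 * N
          + L * G * suc H₀) + 0 ≡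
          49 * N + (L * G * W + L * x + 7 * (L * suc H₀ * G) + 7 * (L * suc H₀) + L * G * 1)
      e = solve-∀

    code-injective : ∀ {b W b₂ W₂} → Shift N L H b W → Shift N L H b₂ W₂ → code b W ≡ code b₂ W₂ → b ≡ b₂
    code-injective {b} {W} {b₂} {W₂} S S₂ eq with pair-injective G W (b % G) W₂ (b₂ % G) (m%n<n b G)
        (m%n<n b₂ G) eq
    ... | refl , b≡b₂%G with ≤-total b b₂
    ... | inj₁ b≤b₂ = same-shift N L H W b (Shift.r S) (Shift.r′ S) b₂ (Shift.r S₂) (Shift.r′ S₂) G (Shift.WN S)
        (Shift.WN S₂)
                        (Shift.r≤ S) (Shift.r′≤ S₂) 6N<LHG b≤b₂ b≡b₂%G
    ... | inj₂ b₂≤b = sym (same-shift N L H W b₂ (Shift.r S₂) (Shift.r′ S₂) b (Shift.r S) (Shift.r′ S) G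
        (Shift.WN S₂) (Shift.WN S)
                        (Shift.r≤ S₂) (Shift.r′≤ S) 6N<LHG b₂≤b (sym b≡b₂%G))

  -- The injective encoding of a family of unhidden cubes

  bit : Bool → Fin 2
  bit false = F.zero
  bit true  = F.suc F.zero

  bit-injective : ∀ x y → bit x ≡ bit y → x ≡ y
  bit-injective false false _ = refl
  bit-injective true  true  _ = refl

  funToFin-cong : ∀ {m k} {f g : Fin m → Fin k} → (∀ i → f i ≡ g i) → funToFin f ≡ funToFin g
  funToFin-cong {zero}  f≗g = refl
  funToFin-cong {suc m} f≗g = cong₂ combine (f≗g F.zero) (funToFin-cong λ i → f≗g (F.suc i))

  -- Geometry enters only through `co≤`, the 45° cone, and `unhidden`. The hiding cubes are sought
  -- among the s counted ones themselves.
  module Count (m n L₀ κ s : ℕ) (n<2^ : n < 2 ^ suc κ)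
    (ax : Fin s → Fin (suc m)) (sg : Fin s → Fin m → Bool) (ht : Fin s → ℕ) (co : Fin s → Fin m → ℕ)
    (ht< : ∀ j → ht j < n) (co≤ : ∀ j l → co j l ≤ ht j + 6)
    (determined : ∀ j j′ → ax j ≡ ax j′ → ht j ≡ ht j′ → (∀ l → co j l ≡ co j′ l) → j ≡ j′)
    (unhidden : ∀ j j′ H → ax j ≡ ax j′ → ht j ≡ ht j′ + H → 1 ≤ H → 2 ≤ ht j′ →
      ¬ (∀ l → ∃[ W ] co j l ≡ co j′ l + W × Passes (sg j l) H W (ht j) (co j l) (ht j′) (co j′ l)))
    where

    L : ℕ
    L = suc L₀

    opaque
      lv : Fin s → ℕ
      lv j = proj₁ (log₂-bracket (ht j))

      Nₖ : ℕ → ℕ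
      Nₖ k = 2 ^ suc k

      Nₖ-nonZero : ∀ k → NonZero (Nₖ k)
      Nₖ-nonZero k = m^n≢0 2 (suc k)

      g< : ∀ j → suc (ht j) < Nₖ (lv j)
      g< j = proj₂ (proj₂ (log₂-bracket (ht j)))

      N≤2g : ∀ j → Nₖ (lv j) ≤ 2 * suc (ht j)
      N≤2g j = 2 ⊠ proj₁ (proj₂ (log₂-bracket (ht j)))

      lv≤κ : ∀ j → lv j < suc κ
      lv≤κ j = ≮⇒≥ λ κ<lv → <⇒≱ n<2^ (≤-trans (^-monoʳ-≤ 2 (≤-pred κ<lv))
          (≤-trans (proj₁ (proj₂ (log₂-bracket (ht j)))) (ht< j)))

    instance
      Nₖ≢0 : ∀ {k} → NonZero (Nₖ k)
      Nₖ≢0 {k} = Nₖ-nonZero k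

    N≤2n : ∀ j → Nₖ (lv j) ≤ 2 * n
    N≤2n j = ≤-trans (N≤2g j) (2 ⊠ ht< j)

    -- Equal values of blockₖ force 4000 H < Nₖ, and equal values of diagₖ force positions to differ by 80 H up to
    -- Nₖ / L, hence by 40 H to 120 H as soon as Nₖ ≤ 40 H L.
    bₖ rₖ diagₖ : ℕ → Fin s → Fin m → ℕ
    bₖ k j l = (co j l * Nₖ k) / suc (ht j)
    rₖ k j l = (co j l * Nₖ k) % suc (ht j)
    diagₖ k j l = (L * (position (sg j l) (Nₖ k) (rₖ k j l) + 80 * (Nₖ k ∸ suc (ht j)))) / Nₖ k

    blockₖ : ℕ → Fin s → ℕ
    blockₖ k j = (4000 * suc (ht j)) / Nₖ k

    aN : ∀ k j l → co j l * Nₖ k ≡ rₖ k j l + bₖ k j l * suc (ht j)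
    aN k j l = m≡m%n+[m/n]*n (co j l * Nₖ k) (suc (ht j))

    b diag : Fin s → Fin m → ℕ
    b j = bₖ (lv j) j
    diag j = diagₖ (lv j) j

    block : Fin s → ℕ
    block j = blockₖ (lv j) j

    -- Since co ≤ h + 6 ≤ 6(h + 1), slopes are at most 6. The bounds 6N on directions and 6H on
    -- shifts all go back to this.
    b≤6N : ∀ j l → b j l ≤ 6 * Nₖ (lv j)
    b≤6N j l = subst (b j l ≤_) (m*n/n≡m (6 * Nₖ (lv j)) (suc (ht j)))
      (/-monoˡ-≤ (suc (ht j)) (lin (co j l * Nₖ (lv j)) (6 * Nₖ (lv j) * suc (ht j)) (5 * (Nₖ (lv j) * ht j))
          (Nₖ (lv j) ⊠ co≤ j l) (e (co j l) (Nₖ (lv j)) (ht j))))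
      where
      e : ∀ c N h → c * N + N * (h + 6) + 5 * (N * h) ≡ 6 * N * suc h + N * c
      e = solve-∀

    b< : ∀ j l → b j l < suc (12 * n)
    b< j l = s≤s (≤-trans (b≤6N j l) (≤-trans (6 ⊠ N≤2n j) (≤-reflexive (e n))))
      where
      e : ∀ n → 6 * (2 * n) ≡ 12 * n
      e = solve-∀

    block< : ∀ j → block j < 4000
    block< j = m<n*o⇒m/o<n (*-monoʳ-< 4000 (g< j))

    position≤ : ∀ σ N r → r ≤ N → position σ N r ≤ N
    position≤ false N r r≤N = r≤N
    position≤ true  N r r≤N = m∸n≤m N r

    diag< : ∀ j l → diag j l < suc (81 * L)
    diag< j l = s≤s (subst (diag j l ≤_) (m*n/n≡m (81 * L) N) (/-monoˡ-≤ N
        (≤-trans (L ⊠ (position≤ (sg j l) N r (<⇒≤ (<-trans (m%n<n (co j l * N) (suc (ht j))) (g< j)))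
            ⊞ 80 ⊠ m∸n≤m N (suc (ht j)))) (≤-reflexive (e L N)))))
      where
      N r : ℕ
      N = Nₖ (lv j)
      r = rₖ (lv j) j l
      e : ∀ L N → L * (N + 80 * N) ≡ 81 * L * N
      e = solve-∀

    record SameClass (j j′ : Fin s) : Set where
      field
        ax≡ : ax j ≡ ax j′
        lv≡ : lv j ≡ lv j′
        sg≡ : ∀ l → sg j l ≡ sg j′ l
        block≡ : block j ≡ block j′
        diag≡ : ∀ l → diag j l ≡ diag j′ l

    opaque
      -- Only two factors grow with n: the number of levels, about log n, and the last one, about
      -- L^m.
      Z₁ : ℕ
      Z₁ = suc m * (suc κ * (2 ^ m * (4000 * suc (81 * L) ^ m)))

      Z₂ : ℕ
      Z₂ = suc (12 * n) ^ m

      Z₁≡ : Z₁ ≡ suc m * (suc κ * (2 ^ m * (4000 * suc (81 * L) ^ m)))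
      Z₁≡ = refl

      Z₂≡ : Z₂ ≡ suc (12 * n) ^ m
      Z₂≡ = refl

      class : Fin s → Fin Z₁
      class j = combine (ax j) (combine (lv j mod suc κ) (combine (funToFin λ l → bit (sg j l))
        (combine (block j mod 4000) (funToFin λ l → diag j l mod suc (81 * L)))))

      offset : Fin s → Fin Z₂
      offset j = funToFin λ l → b j l mod suc (12 * n)

      same-class : ∀ j j′ → class j ≡ class j′ → SameClass j j′
      same-class j j′ eq =
        let (e₁ , eq₁) = F.combine-injective (ax j) _ (ax j′) _ eq
            (e₂ , eq₂) = F.combine-injective (lv j mod suc κ) _ (lv j′ mod suc κ) _ eq₁
            (e₃ , eq₃) = F.combine-injective (funToFin λ l → bit (sg j l)) _ (funToFin λ l → bit (sg j′ l)) _ eq₂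
            (e₄ , e₅) = F.combine-injective (block j mod 4000) _ (block j′ mod 4000) _ eq₃
        in record
          { ax≡ = e₁
          ; lv≡ = mod-injective (suc κ) (lv≤κ j) (lv≤κ j′) e₂
          ; sg≡ = λ l → bit-injective _ _ (funToFin-injective (λ l → bit (sg j l)) (λ l → bit (sg j′ l)) e₃ l)
          ; block≡ = mod-injective 4000 (block< j) (block< j′) e₄
          ; diag≡ = λ l → mod-injective (suc (81 * L)) (diag< j l) (diag< j′ l)
              (funToFin-injective (λ l → diag j l mod suc (81 * L)) (λ l → diag j′ l mod suc (81 * L)) e₅ l)
          }

      same-offset : ∀ j j′ → offset j ≡ offset j′ → ∀ l → b j l ≡ b j′ l
      same-offset j j′ eq l = mod-injective (suc (12 * n)) (b< j l) (b< j′ l)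
        (funToFin-injective (λ l → b j l mod suc (12 * n)) (λ l → b j′ l mod suc (12 * n)) eq l)

      offset-cong : ∀ j j′ → (∀ l → b j l ≡ b j′ l) → offset j ≡ offset j′
      offset-cong j j′ eq = funToFin-cong λ l → cong (_mod suc (12 * n)) (eq l)

    key : Fin s → Fin (Z₁ * Z₂)
    key j = combine (class j) (offset j)

    opaque
      rep : Fin s → Fin s
      rep j = proj₁ (least key ht j)

      rep-key : ∀ j → key (rep j) ≡ key j
      rep-key j = proj₁ (proj₂ (least key ht j))

      rep-min : ∀ j i → key i ≡ key j → ht (rep j) ≤ ht i
      rep-min j = proj₂ (proj₂ (least key ht j))

    same-key : ∀ j j′ → key j ≡ key j′ → class j ≡ class j′ × offset j ≡ offset j′
    same-key j j′ = F.combine-injective (class j) (offset j) (class j′) (offset j′)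

    rep-class : ∀ j → SameClass j (rep j)
    rep-class j = same-class j (rep j) (sym (proj₁ (same-key (rep j) j (rep-key j))))

    rep-offset : ∀ j l → b j l ≡ b (rep j) l
    rep-offset j = same-offset j (rep j) (sym (proj₂ (same-key (rep j) j (rep-key j))))

    rep≤ : ∀ j → ht (rep j) ≤ ht j
    rep≤ j = rep-min j j refl

    -- Equal keys may still have different representatives. Minimality makes the heights agree,
    -- which is all that decoding requires.
    rep-ht : ∀ j j′ → key j ≡ key j′ → ht (rep j) ≡ ht (rep j′)
    rep-ht j j′ eq = ≤-antisym (rep-min j (rep j′) (trans (rep-key j′) (sym eq)))
                               (rep-min j′ (rep j) (trans (rep-key j) eq))

    rise : Fin s → ℕ
    rise j = ht j ∸ ht (rep j)

    ht≡ : ∀ j → ht j ≡ ht (rep j) + rise j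
    ht≡ j = sym (m+[n∸m]≡n (rep≤ j))

    4000H<N : ∀ j → 4000 * rise j < Nₖ (lv j)
    4000H<N j = +-cancelˡ-< (4000 * suc (ht (rep j))) _ _ (subst (_< 4000 * suc (ht (rep j)) + Nₖ (lv j))
        (e (ht (rep j)) (rise j) (ht j) (ht≡ j))
      (/-≡⇒< (4000 * suc (ht j)) (4000 * suc (ht (rep j))) (Nₖ (lv j))
        (trans (SameClass.block≡ (rep-class j)) (cong (λ k → blockₖ k (rep j))
            (sym (SameClass.lv≡ (rep-class j)))))))
      where
      e : ∀ h′ H h → h ≡ h′ + H → 4000 * suc h ≡ 4000 * suc h′ + 4000 * H
      e h′ H _ refl = eq h′ H
        where
        eq : ∀ h′ H → 4000 * suc (h′ + H) ≡ 4000 * suc h′ + 4000 * H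
        eq = solve-∀

    module P (j : Fin s) (1≤H : 1 ≤ rise j) (l : Fin m) =
      Pair (Nₖ (lv j)) L (ht j) (ht (rep j)) (rise j) (co j l) (co (rep j) l) (b j l) (rₖ (lv j) j l)
          (rₖ (lv j) (rep j) l)
        (sg j l) (ht≡ j) 1≤H (aN (lv j) j l)
        (trans (aN (lv j) (rep j) l) (cong (λ z → rₖ (lv j) (rep j) l + z * suc (ht (rep j)))
          (sym (trans (rep-offset j l) (cong (λ k → bₖ k (rep j) l) (sym (SameClass.lv≡ (rep-class j))))))))
        (m%n<n (co j l * Nₖ (lv j)) (suc (ht j))) (m%n<n (co (rep j) l * Nₖ (lv j)) (suc (ht (rep j)))) (g< j)
            (N≤2g j) (b≤6N j l) (4000H<N j)
        (trans (trans (SameClass.diag≡ (rep-class j) l) (cong (λ k → diagₖ k (rep j) l)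
            (sym (SameClass.lv≡ (rep-class j)))))
          (cong (λ σ → (L * (position σ (Nₖ (lv j)) (rₖ (lv j) (rep j) l)
              + 80 * (Nₖ (lv j) ∸ suc (ht (rep j))))) / Nₖ (lv j)) (sym (SameClass.sg≡ (rep-class j) l))))

    -- Otherwise `P.passes` applies in every coordinate at once and the representative hides j. This
    -- is the only use of `unhidden`.
    40HL<N : ∀ j → 1 ≤ rise j → 40 * (rise j * L) < Nₖ (lv j)
    40HL<N j 1≤H = ≰⇒> λ large → unhidden j (rep j) (rise j) (SameClass.ax≡ (rep-class j)) (ht≡ j) 1≤H 2≤h′
        λ l → P.W j 1≤H l , P.a≡ j 1≤H l , P.passes j 1≤H l large
      where
      2000H≤h : 2000 * rise j ≤ ht j
      2000H≤h = drop-4000 (ht j) (rise j) (Nₖ (lv j)) (4000H<N j) (N≤2g j)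
      2≤h′ : 2 ≤ ht (rep j)
      2≤h′ = lin 2 (ht (rep j)) 1997 (2000H≤h ⊞ ≤-reflexive (ht≡ j) ⊞ 1999 ⊠ 1≤H) (e (ht j) (ht (rep j)) (rise j))
        where
        e : ∀ h h′ H → 2 + (h + (h′ + H) + 1999 * H) + 1997 ≡ h′ + (2000 * H + h + 1999 * 1)
        e = solve-∀

    W : Fin s → Fin m → ℕ
    W j l = co j l ∸ co (rep j) l

    shift : ∀ j → 1 ≤ rise j → ∀ l → Shift (Nₖ (lv j)) L (rise j) (b j l) (W j l)
    shift j 1≤H l = record { r = rₖ (lv j) j l ; r′ = rₖ (lv j) (rep j) l ; WN = P.WN j 1≤H l ; W≤6H =
        P.W≤6H j 1≤H l
      ; r≤ = proj₁ (P.close j 1≤H l (40HL<N j 1≤H)) ; r′≤ = proj₂ (P.close j 1≤H l (40HL<N j 1≤H)) }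

    LH≤N : ∀ j → 1 ≤ rise j → L * rise j ≤ Nₖ (lv j)
    LH≤N j 1≤H = lin (L * rise j) (Nₖ (lv j)) (1 + 39 * (L * rise j)) (40HL<N j 1≤H) (e L (rise j) (Nₖ (lv j)))
      where
      e : ∀ L H N → L * H + N + (1 + 39 * (L * H)) ≡ N + suc (40 * (H * L))
      e = solve-∀

    quotient-bound : ∀ x k → L * x ≤ k → x < suc (k / L)
    quotient-bound x k Lx≤k =
        s≤s (subst (_≤ k / L) (m*n/n≡m x L) (/-monoˡ-≤ L (≤-trans (≤-reflexive (*-comm x L)) Lx≤k)))

    opaque
      -- Strict bounds for a positive rise and for the code of one coordinate; 98 is 49 from
      -- `code-bound` times 2 from N ≤ 2n.
      Z₃ Z₄ : ℕ
      Z₃ = suc (n / L)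
      Z₄ = suc ((98 * n) / L)

      Z₃≡ : Z₃ ≡ suc (n / L)
      Z₃≡ = refl

      Z₄≡ : Z₄ ≡ suc ((98 * n) / L)
      Z₄≡ = refl

      Z₃-nonZero : NonZero Z₃
      Z₃-nonZero = nonZero

      Z₄-nonZero : NonZero Z₄
      Z₄-nonZero = nonZero

      rise< : ∀ j → 1 ≤ rise j → rise j < Z₃
      rise< j 1≤H = quotient-bound (rise j) n (*-cancelˡ-≤ 2 (lin (2 * (L * rise j)) (2 * n)
          (1 + 38 * (L * rise j)) (40HL<N j 1≤H ⊞ N≤2n j) (e L (rise j) (Nₖ (lv j)) n)))
        where
        e : ∀ L H N n → 2 * (L * H) + (N + 2 * n) + (1 + 38 * (L * H)) ≡ 2 * n + (suc (40 * (H * L)) + N)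
        e = solve-∀

      codeₗ : (N H₀ : ℕ) → Fin s → Fin m → ℕ
      codeₗ N H₀ j l = Code.code L₀ N H₀ (b j l) (W j l)

      codeₗ< : ∀ j H₀ → rise j ≡ suc H₀ → ∀ l → codeₗ (Nₖ (lv j)) H₀ j l < Z₄
      codeₗ< j H₀ eq l = quotient-bound (Code.code L₀ (Nₖ (lv j)) H₀ (b j l) (W j l)) (98 * n)
          (≤-trans (Code.code-bound L₀ (Nₖ (lv j)) H₀ {b j l} {W j l}
          (subst (λ H → W j l ≤ 6 * H) eq (Shift.W≤6H (shift j 1≤H l))) (subst (λ H → L * H ≤ Nₖ (lv j)) eq
              (LH≤N j 1≤H)))
          (≤-trans (49 ⊠ N≤2n j) (≤-reflexive (e n))))
        where
        1≤H : 1 ≤ rise j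
        1≤H = subst (1 ≤_) (sym eq) (s≤s z≤n)
        e : ∀ n → 49 * (2 * n) ≡ 98 * n
        e = solve-∀

      codeₗ-injective : ∀ N H₀ j j′ l → Shift N L (suc H₀) (b j l) (W j l) → Shift N L (suc H₀) (b j′ l)
          (W j′ l) →
        codeₗ N H₀ j l ≡ codeₗ N H₀ j′ l → b j l ≡ b j′ l
      codeₗ-injective N H₀ j j′ l = Code.code-injective L₀ N H₀

    instance
      Z₃≢0 : NonZero Z₃
      Z₃≢0 = Z₃-nonZero

      Z₄≢0 : NonZero Z₄
      Z₄≢0 = Z₄-nonZero

    opaque
      codes : Fin s → ℕ → Fin (Z₄ ^ m)
      codes j H₀ = funToFin λ l → codeₗ (Nₖ (lv j)) H₀ j l mod Z₄

      codes-injective : ∀ j j′ H₀ → lv j ≡ lv j′ → rise j ≡ suc H₀ → rise j′ ≡ suc H₀ → codes j H₀ ≡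
          codes j′ H₀ → ∀ l → b j l ≡ b j′ l
      codes-injective j j′ H₀ lv≡ eq eq′ codes≡ l = codeₗ-injective (Nₖ (lv j)) H₀ j j′ l
        (subst (λ H → Shift (Nₖ (lv j)) L H (b j l) (W j l)) eq (shift j (subst (1 ≤_) (sym eq) (s≤s z≤n)) l))
        (subst₂ (λ H k → Shift (Nₖ k) L H (b j′ l) (W j′ l)) eq′ (sym lv≡)
            (shift j′ (subst (1 ≤_) (sym eq′) (s≤s z≤n)) l))
        (trans (mod-injective Z₄ (codeₗ< j H₀ eq l) (codeₗ< j′ H₀ eq′ l)
           (funToFin-injective (λ l → codeₗ (Nₖ (lv j)) H₀ j l mod Z₄) (λ l → codeₗ (Nₖ (lv j′)) H₀ j′ l mod Z₄)
               codes≡ l))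
          (cong (λ k → codeₗ (Nₖ k) H₀ j′ l) (sym lv≡)))

    -- At rise 0 the comparison with the representative says nothing about b, so the whole direction
    -- vector is stored, but no height. A positive rise is stored together with the shorter codes
    -- that it makes possible.
    tail : Fin s → ℕ → Fin Z₂ ⊎ Fin (Z₃ * Z₄ ^ m)
    tail j zero     = inj₁ (offset j)
    tail j (suc H₀) = inj₂ (combine (suc H₀ mod Z₃) (codes j H₀))

    tail-injective : ∀ j j′ → lv j ≡ lv j′ → ∀ H H′ → rise j ≡ H → rise j′ ≡ H′ → tail j H ≡ tail j′ H′ →
      H ≡ H′ × (∀ l → b j l ≡ b j′ l)
    tail-injective j j′ lv≡ zero zero eq eq′ tails = refl , same-offset j j′ (inj₁-injective tails)
    tail-injective j j′ lv≡ (suc H₀) (suc H₀′) eq eq′ tails = H≡ , codes-injective j j′ H₀ lv≡ eq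
        (trans eq′ (sym H≡))
        (trans (proj₂ split) (cong (codes j′) (sym (suc-injective H≡))))
      where
      split : suc H₀ mod Z₃ ≡ suc H₀′ mod Z₃ × codes j H₀ ≡ codes j′ H₀′
      split = F.combine-injective (suc H₀ mod Z₃) (codes j H₀) (suc H₀′ mod Z₃) (codes j′ H₀′)
          (inj₂-injective tails)
      bound : ∀ j H₀ → rise j ≡ suc H₀ → suc H₀ < Z₃
      bound j H₀ eq = subst (_< Z₃) eq (rise< j (subst (1 ≤_) (sym eq) (s≤s z≤n)))
      H≡ : suc H₀ ≡ suc H₀′
      H≡ = mod-injective Z₃ (bound j H₀ eq) (bound j′ H₀′ eq′) (proj₁ split)

    encode : Fin s → Fin (Z₁ * (Z₂ + Z₃ * Z₄ ^ m))
    encode j = combine (class j) (join Z₂ (Z₃ * Z₄ ^ m) (tail j (rise j)))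

    -- The tail reveals the rise and the directions. Class and directions give the key, hence the
    -- representative's height; adding the rise recovers the height, and with b the remaining
    -- coordinates.
    encode-injective : ∀ {j j′} → encode j ≡ encode j′ → j ≡ j′
    encode-injective {j} {j′} eq = determined j j′ ax≡ h≡ co≡
      where
      classes = F.combine-injective (class j) (join Z₂ (Z₃ * Z₄ ^ m) (tail j (rise j))) (class j′)
          (join Z₂ (Z₃ * Z₄ ^ m) (tail j′ (rise j′))) eq
      open SameClass (same-class j j′ (proj₁ classes))
      tails : rise j ≡ rise j′ × (∀ l → b j l ≡ b j′ l)
      tails = tail-injective j j′ lv≡ (rise j) (rise j′) refl refl (join-injective (tail j (rise j))
          (tail j′ (rise j′)) (proj₂ classes))
      keys : key j ≡ key j′
      keys = cong₂ combine (proj₁ classes) (offset-cong j j′ (proj₂ tails))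
      h≡ : ht j ≡ ht j′
      h≡ = trans (ht≡ j) (trans (cong₂ _+_ (rep-ht j j′ keys) (proj₁ tails)) (sym (ht≡ j′)))
      co≡ : ∀ l → co j l ≡ co j′ l
      co≡ l = ≤-antisym (co-≤ j j′ lv≡ h≡ (proj₂ tails l)) (co-≤ j′ j (sym lv≡) (sym h≡) (sym (proj₂ tails l)))
        where
        -- co · N lies in [g b , g b + g) and g < N.
        co-≤ : ∀ j j′ → lv j ≡ lv j′ → ht j ≡ ht j′ → b j l ≡ b j′ l → co j l ≤ co j′ l
        co-≤ j j′ lv≡ h≡ b≡ = ≤-pred (*-cancelʳ-< (Nₖ (lv j′)) (co j l) (suc (co j′ l)) (begin-strict
          co j l * Nₖ (lv j′)                          ≡⟨ cong (λ k → co j l * Nₖ k) lv≡ ⟨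
          co j l * Nₖ (lv j)                           ≡⟨ aN (lv j) j l ⟩
          rₖ (lv j) j l + b j l * suc (ht j)           <⟨ +-monoˡ-< (b j l * suc (ht j))
              (<-trans (m%n<n (co j l * Nₖ (lv j)) (suc (ht j))) (g< j)) ⟩
          Nₖ (lv j) + b j l * suc (ht j)               ≡⟨ cong₂ (λ k x → Nₖ k + x) lv≡
              (cong₂ (λ p q → p * suc q) b≡ h≡) ⟩
          Nₖ (lv j′) + b j′ l * suc (ht j′)            ≤⟨ +-monoʳ-≤ (Nₖ (lv j′))
              (≤-trans (m≤n+m _ (rₖ (lv j′) j′ l)) (≤-reflexive (sym (aN (lv j′) j′ l)))) ⟩
          Nₖ (lv j′) + co j′ l * Nₖ (lv j′)            ∎))
          where open ≤-Reasoning

    count : s ≤ Z₁ * (Z₂ + Z₃ * Z₄ ^ m)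
    count = F.injective⇒≤ encode-injective

-- One transverse coordinate of a segment, over the rationals

module Rays where

  open import Data.Bool using (Bool; true; false; if_then_else_)
  open import Data.Empty using (⊥; ⊥-elim)
  open import Data.Fin using (Fin; zero; suc)
  open import Data.Fin.Properties using () renaming (_≟_ to _≟F_)
  import Data.Integer as ℤ
  import Data.Integer.Properties as ℤP
  open import Data.Nat as ℕ using (ℕ)
  open import Data.Nat.Coprimality using (1-coprimeTo) renaming (sym to coprime-sym)
  import Data.Nat.Properties as ℕP
  open import Data.Product
  open import Data.Rational
  open import Data.Rational.Properties
  open import Data.Sum using (inj₁; inj₂)
  open import Data.Vec.Functional using (foldr)
  open import Function using (_∘_)
  open import Level using (0ℓ)
  open import Relation.Binary.PropositionalEquality
  open import Relation.Nullary
  open import Relation.Nullary.Decidable using (dec⇒maybe)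
  open import Relation.Unary using (Pred; _∈_)
  open import Tactic.RingSolver
  open import Tactic.RingSolver.Core.AlmostCommutativeRing
  open Counting using (Clears; Passes)

  ring : AlmostCommutativeRing _ _
  ring = fromCommutativeRing +-*-commutativeRing (λ x → dec⇒maybe (0ℚ ≟ x))

  infixl 6 _⊕_
  infixl 7 _⊗_

  -- Inequalities are kept in the form 0 ≤ p, so that an estimate amounts to one ring identity
  -- writing its difference as sums and products of nonnegative terms.
  _⊕_ : ∀ {p q} → 0ℚ ≤ p → 0ℚ ≤ q → 0ℚ ≤ p + q
  _⊕_ = +-mono-≤

  _⊗_ : ∀ {p q} → 0ℚ ≤ p → 0ℚ ≤ q → 0ℚ ≤ p * q
  _⊗_ {p} {q} 0≤p 0≤q = nonNegative⁻¹ _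
    {{nonNeg*nonNeg⇒nonNeg p {{nonNegative 0≤p}} q {{nonNegative 0≤q}}}}

  ≤⇒0≤- : ∀ {p q} → p ≤ q → 0ℚ ≤ q - p
  ≤⇒0≤- {p} {q} p≤q = subst (_≤ q - p) (+-inverseʳ p) (+-monoˡ-≤ (- p) p≤q)

  0≤-⇒≤ : ∀ {p q} → 0ℚ ≤ q - p → p ≤ q
  0≤-⇒≤ {p} {q} h = subst₂ _≤_ (+-identityˡ p) (eq q p) (+-monoˡ-≤ p h)
    where
    eq : ∀ q p → (q - p) + p ≡ q
    eq = solve-∀ ring

  0≤-≡ : ∀ {p q} → 0ℚ ≤ p → q ≡ p → 0ℚ ≤ q
  0≤-≡ 0≤p eq = subst (0ℚ ≤_) (sym eq) 0≤p

  2ℚ 4ℚ 8ℚ 16ℚ 32ℚ 64ℚ : ℚ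
  2ℚ = 1ℚ + 1ℚ
  4ℚ = 2ℚ + 2ℚ
  8ℚ = 4ℚ + 4ℚ
  16ℚ = 8ℚ + 8ℚ
  32ℚ = 16ℚ + 16ℚ
  64ℚ = 32ℚ + 32ℚ

  0≤1 : 0ℚ ≤ 1ℚ
  0≤1 = nonNegative⁻¹ 1ℚ

  0≤2 : 0ℚ ≤ 2ℚ
  0≤2 = nonNegative⁻¹ 2ℚ

  0≤4 : 0ℚ ≤ 4ℚ
  0≤4 = nonNegative⁻¹ 4ℚ

  0≤8 : 0ℚ ≤ 8ℚ
  0≤8 = nonNegative⁻¹ 8ℚ

  0≤16 : 0ℚ ≤ 16ℚ
  0≤16 = nonNegative⁻¹ 16ℚ

  halve : ∀ {p} → 0ℚ ≤ 2ℚ * p → 0ℚ ≤ p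
  halve {p} h = *-cancelˡ-≤-pos 2ℚ (subst (_≤ 2ℚ * p) (sym (*-zeroʳ 2ℚ)) h)

  -- Y is the increase along the facet's axis, I its reciprocal, V the shift W, and η the tolerance
  -- with which terms of the real sequences satisfy the geometric bounds. A and A′ are rationals so
  -- that the reflection x ↦ 1 - x, which maps the observer's interval to itself, can replace a and
  -- a′ by -a and -a′.
  module Crossing
    (x y Y I h H A A′ V η : ℚ) (YI≡1 : Y * I ≡ 1ℚ)
    (0≤I : 0ℚ ≤ I) (0≤H : 0ℚ ≤ H) (0≤V : 0ℚ ≤ V) (0≤η : 0ℚ ≤ η)
    (4ηh≤1 : 0ℚ ≤ 1ℚ - 4ℚ * η * h)
    (-η≤x : 0ℚ ≤ x + η) (x≤1+η : 0ℚ ≤ 1ℚ + η - x)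
    (A-η≤y : 0ℚ ≤ y - A + η) (y≤A+1+η : 0ℚ ≤ A + 1ℚ + η - y)
    (y-low : 0ℚ ≤ 4ℚ * A + 2ℚ + 1ℚ - 4ℚ * y)
    (Y≥ : 0ℚ ≤ Y - (h - 1ℚ - 2ℚ * η)) (Y≤ : 0ℚ ≤ h + 1ℚ + 2ℚ * η - Y)
    (-V≤ : 0ℚ ≤ V + (A - A′)) (≤V : 0ℚ ≤ V - (A - A′))
    (drift≥ : 0ℚ ≤ h * (A - A′) - H * A - (V + H + 1ℚ))
    (drift≤ : 0ℚ ≤ h - 8ℚ * (h * (A - A′) - H * A + (V + H + 1ℚ)))
    where

    -- The two drift bounds together give h ≥ 16(V + H + 1), which meets 4ηh ≤ 1. Every error of the
    -- form η(V + H + 1) is thereby at most 1/64.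
    M≥0 : 0ℚ ≤ 1ℚ - 64ℚ * η * (V + H + 1ℚ)
    M≥0 = 0≤-≡ (0≤4 ⊗ 0≤η ⊗ (drift≤ ⊕ 0≤8 ⊗ drift≥) ⊕ 4ηh≤1) (eq h H A A′ V η)
      where
      eq : ∀ h H A A′ V η → 1ℚ - 64ℚ * η * (V + H + 1ℚ) ≡
        4ℚ * η * ((h - 8ℚ * (h * (A - A′) - H * A + (V + H + 1ℚ))) +
                  8ℚ * (h * (A - A′) - H * A - (V + H + 1ℚ))) + (1ℚ - 4ℚ * η * h)
      eq = solve-∀ ring

    1-η≥0 : 0ℚ ≤ 1ℚ - η
    1-η≥0 = 0≤-≡ (M≥0 ⊕ (0≤16 ⊕ 0≤16 ⊕ 0≤16 ⊕ 0≤8 ⊕ 0≤4 ⊕ 0≤2 ⊕ 0≤1) ⊗ 0≤η ⊕ (0≤16 ⊕ 0≤16 ⊕ 0≤16 ⊕ 0≤16) ⊗ 0≤η ⊗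
        (0≤V ⊕ 0≤H)) (eq H V η)
      where
      eq : ∀ H V η → 1ℚ - η ≡ (1ℚ - 64ℚ * η * (V + H + 1ℚ)) +
           (16ℚ + 16ℚ + 16ℚ + 8ℚ + 4ℚ + 2ℚ + 1ℚ) * η + (16ℚ + 16ℚ + 16ℚ + 16ℚ) * η * (V + H)
      eq = solve-∀ ring

    0≤Y : 0ℚ ≤ Y
    0≤Y = 0≤-≡ (Y≥ ⊕ drift≤ ⊕ 0≤8 ⊗ drift≥ ⊕ 0≤16 ⊗ (0≤V ⊕ 0≤H) ⊕ (0≤8 ⊕ 0≤4 ⊕ 0≤1) ⊕ 0≤2 ⊗ 1-η≥0)
        (eq Y h H A A′ V η)
      where
      eq : ∀ Y h H A A′ V η → Y ≡ (Y - (h - 1ℚ - 2ℚ * η)) + (h - 8ℚ * (h * (A - A′) - H * A + (V + H + 1ℚ)))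
        + 8ℚ * (h * (A - A′) - H * A - (V + H + 1ℚ)) + 16ℚ * (V + H) + (8ℚ + 4ℚ + 1ℚ) + 2ℚ * (1ℚ - η)
      eq = solve-∀ ring

    R≥0 : 0ℚ ≤ 2ℚ * (2ℚ * (h * (A - A′) - H * A - V - H) - 4ℚ * η * (V + H) - 2ℚ * η * Y)
    R≥0 = 0≤-≡ (0≤4 ⊗ drift≥ ⊕ 0≤4 ⊗ 0≤η ⊗ Y≤ ⊕ 0≤8 ⊗ 0≤η ⊗ 1-η≥0 ⊕ M≥0 ⊕ 0≤2 ⊕
                (0≤16 ⊕ 0≤16 ⊕ 0≤16 ⊕ 0≤8) ⊗ 0≤η ⊗ (0≤V ⊕ 0≤H) ⊕ (0≤16 ⊕ 0≤16 ⊕ 0≤16 ⊕ 0≤4) ⊗ 0≤η ⊕ 4ηh≤1)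
               (eq Y h H A A′ V η)
      where
      eq : ∀ Y h H A A′ V η → 2ℚ * (2ℚ * (h * (A - A′) - H * A - V - H) - 4ℚ * η * (V + H) - 2ℚ * η * Y) ≡
        4ℚ * (h * (A - A′) - H * A - (V + H + 1ℚ)) + 4ℚ * η * (h + 1ℚ + 2ℚ * η - Y) + 8ℚ * η * (1ℚ - η)
            + (1ℚ - 64ℚ * η * (V + H + 1ℚ)) + 2ℚ
        + (16ℚ + 16ℚ + 16ℚ + 8ℚ) * η * (V + H) + (16ℚ + 16ℚ + 16ℚ + 4ℚ) * η + (1ℚ - 4ℚ * η * h)
      eq = solve-∀ ring

    -- This is Y times the distance from the lower wall. Replacing Y, y and x by h, A and 0 costs
    -- about V + H, which `drift≥` pays. The products with V ± (A - A′) bound (Y - h)(A - A′) for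
    -- either sign of its factors.
    E≥0 : 0ℚ ≤ Y * (y - A′) - H * (y - x)
    E≥0 = halve (0≤-≡ (0≤2 ⊗ 0≤Y ⊗ A-η≤y ⊕ Y≥ ⊗ -V≤ ⊕ Y≤ ⊗ ≤V ⊕ 0≤2 ⊗ 0≤H ⊗ (y≤A+1+η ⊕ -η≤x) ⊕ halve R≥0)
          (eq x y Y h H A A′ V η))
      where
      eq : ∀ x y Y h H A A′ V η → 2ℚ * (Y * (y - A′) - H * (y - x)) ≡
        2ℚ * Y * (y - A + η) + (Y - (h - 1ℚ - 2ℚ * η)) * (V + (A - A′)) + (h + 1ℚ + 2ℚ * η - Y) * (V - (A - A′)) +
        2ℚ * H * ((A + 1ℚ + η - y) + (x + η)) +
        (2ℚ * (h * (A - A′) - H * A - V - H) - 4ℚ * η * (V + H) - 2ℚ * η * Y)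
      eq = solve-∀ ring

    -- This is Y times the distance from the upper wall. By `y-low` the end point keeps a quarter of
    -- a cell from its own upper wall, and `drift≤` lets the drift use only an eighth; hence the
    -- factor 8 in `Clears`.
    F≥0 : 0ℚ ≤ Y * (A′ + 1ℚ - y) + H * (y - x)
    F≥0 = halve (halve (halve (0≤-≡
       (0≤2 ⊗ (0≤Y ⊗ y-low ⊕ 0≤2 ⊗ (Y≥ ⊗ ≤V ⊕ Y≤ ⊗ -V≤) ⊕ 0≤4 ⊗ 0≤H ⊗ (A-η≤y ⊕ x≤1+η)) ⊕ drift≤ ⊕ 0≤2 ⊗ Y≥
          ⊕ (drift≤ ⊕ 0≤8 ⊗ drift≥ ⊕ 0≤16 ⊗ (0≤V ⊕ 0≤H ⊕ 0≤1)) ⊕ (0≤4 ⊕ 0≤1) ⊕ M≥0 ⊕ (0≤16 ⊕ 0≤16 ⊕ 0≤16 ⊕ 0≤8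
              ⊕ 0≤4) ⊗ 0≤η ⊕ (0≤16 ⊕ 0≤16 ⊕ 0≤16) ⊗ 0≤η ⊗ (0≤V ⊕ 0≤H))
       (eq x y Y h H A A′ V η))))
      where
      eq : ∀ x y Y h H A A′ V η → 2ℚ * (2ℚ * (2ℚ * (Y * (A′ + 1ℚ - y) + H * (y - x)))) ≡
        2ℚ * (Y * (4ℚ * A + 2ℚ + 1ℚ - 4ℚ * y) + 2ℚ * ((Y - (h - 1ℚ - 2ℚ * η)) * (V - (A - A′))
            + (h + 1ℚ + 2ℚ * η - Y) * (V + (A - A′)))
          + 4ℚ * H * ((y - A + η) + (1ℚ + η - x))) + (h - 8ℚ * (h * (A - A′) - H * A + (V + H + 1ℚ)))
              + 2ℚ * (Y - (h - 1ℚ - 2ℚ * η))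
        + ((h - 8ℚ * (h * (A - A′) - H * A + (V + H + 1ℚ))) + 8ℚ * (h * (A - A′) - H * A - (V + H + 1ℚ))
            + 16ℚ * (V + H + 1ℚ))
        + (4ℚ + 1ℚ) + (1ℚ - 64ℚ * η * (V + H + 1ℚ)) + (16ℚ + 16ℚ + 16ℚ + 8ℚ + 4ℚ) * η
            + (16ℚ + 16ℚ + 16ℚ) * η * (V + H)
      eq = solve-∀ ring

    lower : 0ℚ ≤ (x + (1ℚ - H * I) * (y - x)) - A′
    lower = 0≤-≡ (0≤I ⊗ E≥0) (trans (eq₁ x y I H A′) (trans (cong (λ u → u * (y - A′) - H * I * (y - x))
        (sym YI≡1)) (eq₂ x y Y I H A′)))
      where
      eq₁ : ∀ x y I H A′ → (x + (1ℚ - H * I) * (y - x)) - A′ ≡ 1ℚ * (y - A′) - H * I * (y - x)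
      eq₁ = solve-∀ ring
      eq₂ : ∀ x y Y I H A′ → Y * I * (y - A′) - H * I * (y - x) ≡ I * (Y * (y - A′) - H * (y - x))
      eq₂ = solve-∀ ring

    upper : 0ℚ ≤ A′ + 1ℚ - (x + (1ℚ - H * I) * (y - x))
    upper = 0≤-≡ (0≤I ⊗ F≥0) (trans (eq₁ x y I H A′) (trans (cong (λ u → u * (A′ + 1ℚ - y) + H * I * (y - x))
        (sym YI≡1)) (eq₂ x y Y I H A′)))
      where
      eq₁ : ∀ x y I H A′ → A′ + 1ℚ - (x + (1ℚ - H * I) * (y - x)) ≡ 1ℚ * (A′ + 1ℚ - y) + H * I * (y - x)
      eq₁ = solve-∀ ring
      eq₂ : ∀ x y Y I H A′ → Y * I * (A′ + 1ℚ - y) + H * I * (y - x) ≡ I * (Y * (A′ + 1ℚ - y) + H * (y - x))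
      eq₂ = solve-∀ ring

  -- Naturals, eventual inequalities, reciprocals and halves of a cell

  ι : ℕ → ℚ
  ι n = ℤ.+ n / 1

  ι-mk : ∀ n → ι n ≡ mkℚ (ℤ.+ n) 0 (coprime-sym (1-coprimeTo n))
  ι-mk n = normalize-coprime (coprime-sym (1-coprimeTo n))

  ι-+ : ∀ m n → ι (m ℕ.+ n) ≡ ι m + ι n
  ι-+ m n = sym (trans (cong₂ _+_ (ι-mk m) (ι-mk n))
    (cong (_/ 1) (cong₂ ℤ._+_ (ℤP.*-identityʳ (ℤ.+ m)) (ℤP.*-identityʳ (ℤ.+ n)))))

  ι-* : ∀ m n → ι (m ℕ.* n) ≡ ι m * ι n
  ι-* m n = sym (trans (cong₂ _*_ (ι-mk m) (ι-mk n)) (cong (_/ 1) (sym (ℤP.pos-* m n))))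

  0≤ι : ∀ n → 0ℚ ≤ ι n
  0≤ι n = nonNegative⁻¹ (ι n) {{normalize-nonNeg n 1}}

  ι-≤ : ∀ {m n} → m ℕ.≤ n → 0ℚ ≤ ι n - ι m
  ι-≤ {m} {n} m≤n = 0≤-≡ (0≤ι (n ℕ.∸ m)) (trans (cong (_- ι m) (trans (cong ι (sym (ℕP.m+[n∸m]≡n m≤n)))
      (ι-+ m _)))
    (eq (ι m) (ι (n ℕ.∸ m))))
    where
    eq : ∀ a b → (a + b) - a ≡ b
    eq = solve-∀ ring

  infixr 2 _∧ᵉ_
  _∧ᵉ_ : ∀ {P Q : Pred ℕ 0ℓ} → Eventually P → Eventually Q → Eventually (λ i → P i × Q i)
  (k , p) ∧ᵉ (l , q) = k ℕ.+ l , λ i k+l≤i → p i (ℕP.m+n≤o⇒m≤o k k+l≤i) , q i (ℕP.m+n≤o⇒n≤o k k+l≤i)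

  infixl 1 _▹_
  _▹_ : ∀ {P Q : Pred ℕ 0ℓ} → Eventually P → (∀ i → P i → Q i) → Eventually Q
  (k , p) ▹ f = k , λ i k≤i → f i (p i k≤i)

  ≤ℝ⇒ev : ∀ {x y ε} → x ≤ℝ y → 0ℚ < ε → Eventually (λ i → 0ℚ ≤ seq y i + ε - seq x i)
  ≤ℝ⇒ev x≤y 0<ε = x≤y _ 0<ε ▹ λ _ → ≤⇒0≤-

  ev⇒≤ℝ : ∀ {x y} → Eventually (λ i → 0ℚ ≤ seq y i - seq x i) → x ≤ℝ y
  ev⇒≤ℝ {x} {y} e ε 0<ε = e ▹ λ i p → 0≤-⇒≤ (0≤-≡ (p ⊕ <⇒≤ 0<ε) (eq (seq x i) (seq y i) ε))
    where
    eq : ∀ a b c → b + c - a ≡ (b - a) + c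
    eq = solve-∀ ring

  ≤∣∣ : ∀ p → p ≤ ∣ p ∣
  ≤∣∣ p with ≤-total 0ℚ p
  ... | inj₁ 0≤p = ≤-reflexive (sym (0≤p⇒∣p∣≡p 0≤p))
  ... | inj₂ p≤0 = ≤-trans p≤0 (0≤∣p∣ p)

  0≤sq : ∀ p → 0ℚ ≤ p * p
  0≤sq p with ≤-total 0ℚ p
  ... | inj₁ 0≤p = 0≤p ⊗ 0≤p
  ... | inj₂ p≤0 = 0≤-≡ (neg-antimono-≤ p≤0 ⊗ neg-antimono-≤ p≤0) (eq p)
    where
    eq : ∀ p → p * p ≡ (- p) * (- p)
    eq = solve-∀ ring

  -- Total, with the value 0 at 0, because the sequences to be inverted are at least 1 only
  -- eventually.
  inv : ℚ → ℚ
  inv p with p ≟ 0ℚ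
  ... | yes _   = 0ℚ
  ... | no p≢0 = (1/ p) {{≢-nonZero p≢0}}

  *-inv : ∀ p → 0ℚ ≤ p - 1ℚ → p * inv p ≡ 1ℚ
  *-inv p h with p ≟ 0ℚ
  ... | yes refl = ⊥-elim (≤⇒≯ h (negative⁻¹ (0ℚ - 1ℚ)))
    where ≤⇒≯ : ∀ {a b : ℚ} → a ≤ b → b < a → ⊥
          ≤⇒≯ a≤b b<a = <-irrefl refl (<-≤-trans b<a a≤b)
  ... | no p≢0 = *-inverseʳ p {{≢-nonZero p≢0}}

  0≤inv : ∀ p → 0ℚ ≤ p - 1ℚ → 0ℚ ≤ inv p
  0≤inv p h = 0≤-≡ (0≤p ⊗ 0≤sq (inv p))
    (trans (sym (*-identityˡ (inv p))) (trans (cong (_* inv p) (sym (*-inv p h))) (*-assoc p (inv p) (inv p))))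
    where
    0≤p : 0ℚ ≤ p
    0≤p = 0≤-≡ (h ⊕ 0≤1) (eq p)
      where
      eq : ∀ p → p ≡ (p - 1ℚ) + 1ℚ
      eq = solve-∀ ring

  inv≤1 : ∀ p → 0ℚ ≤ p - 1ℚ → 0ℚ ≤ 1ℚ - inv p
  inv≤1 p h = 0≤-≡ (h ⊗ 0≤inv p h) (trans (cong (_- inv p) (sym (*-inv p h))) (eq p (inv p)))
    where
    eq : ∀ p q → p * q - q ≡ (p - 1ℚ) * q
    eq = solve-∀ ring

  -- The factor relating the two differences is 1/(pq) ≤ 1; the reciprocal is 1-Lipschitz from 1 on
  -- and so preserves Cauchy sequences.
  inv-diff : ∀ p q → 0ℚ ≤ p - 1ℚ → 0ℚ ≤ q - 1ℚ → ∣ inv p - inv q ∣ ≤ ∣ p - q ∣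
  inv-diff p q hp hq = subst₂ _≤_ (sym eq) (*-identityʳ ∣ p - q ∣)
    (*-monoˡ-≤-nonNeg ∣ p - q ∣ {{∣-∣-nonNeg (p - q)}} (0≤-⇒≤ 0≤1-ab))
    where
    a b : ℚ
    a = inv p
    b = inv q
    0≤1-ab : 0ℚ ≤ 1ℚ - a * b
    0≤1-ab = 0≤-≡ (inv≤1 p hp ⊕ 0≤inv p hp ⊗ inv≤1 q hq) (e a b)
      where
      e : ∀ a b → 1ℚ - a * b ≡ (1ℚ - a) + a * (1ℚ - b)
      e = solve-∀ ring
    e₁ : ∀ a b → a - b ≡ a * 1ℚ - 1ℚ * b
    e₁ = solve-∀ ring
    e₂ : ∀ p q a b → a * (q * b) - (p * a) * b ≡ - ((p - q) * (a * b))
    e₂ = solve-∀ ring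
    eq : ∣ a - b ∣ ≡ ∣ p - q ∣ * (a * b)
    eq = begin
      ∣ a - b ∣                        ≡⟨ cong ∣_∣ (e₁ a b) ⟩
      ∣ a * 1ℚ - 1ℚ * b ∣              ≡⟨ cong₂ (λ u v → ∣ a * u - v * b ∣) (sym (*-inv q hq)) (sym (*-inv p hp))
          ⟩
      ∣ a * (q * b) - (p * a) * b ∣    ≡⟨ cong ∣_∣ (e₂ p q a b) ⟩
      ∣ - ((p - q) * (a * b)) ∣        ≡⟨ ∣-p∣≡∣p∣ ((p - q) * (a * b)) ⟩
      ∣ (p - q) * (a * b) ∣            ≡⟨ ∣p*q∣≡∣p∣*∣q∣ (p - q) (a * b) ⟩
      ∣ p - q ∣ * ∣ a * b ∣            ≡⟨ cong (∣ p - q ∣ *_) (0≤p⇒∣p∣≡p (0≤inv p hp ⊗ 0≤inv q hq)) ⟩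
      ∣ p - q ∣ * (a * b)              ∎
      where open ≡-Reasoning

  inv-cauchy : ∀ {s} → IsCauchy s → Eventually (λ i → 0ℚ ≤ s i - 1ℚ) → IsCauchy (inv ∘ s)
  inv-cauchy {s} cs (l , s≥1) ε 0<ε with cs ε 0<ε
  ... | k , h = l ℕ.+ k , λ i j li lj → ≤-<-trans
    (inv-diff (s i) (s j) (s≥1 i (ℕP.m+n≤o⇒m≤o l li)) (s≥1 j (ℕP.m+n≤o⇒m≤o l lj)))
    (h i j (ℕP.m+n≤o⇒n≤o l li) (ℕP.m+n≤o⇒n≤o l lj))

  -- Comparing a real with a midpoint is not decidable, so the halves overlap: one ends at 3/4, the
  -- other starts at 1/4. A single term accurate to 1/4 then decides.
  halfway : (r : ℝ) (a : ℚ) →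
    ∃[ b ] (if b then Eventually (λ i → 0ℚ ≤ 4ℚ * seq r i - (4ℚ * a + 1ℚ))
                 else Eventually (λ i → 0ℚ ≤ 4ℚ * a + 2ℚ + 1ℚ - 4ℚ * seq r i))
  halfway r a with cauchy r (½ * ½) (positive⁻¹ (½ * ½))
  ... | k , h with ≤-total (seq r k) (a + ½)
  ... | inj₁ low = false , k , λ i k≤i →
          0≤-≡ (0≤4 ⊗ ≤⇒0≤- low ⊕ 0≤4 ⊗ ≤⇒0≤- (<⇒≤ (≤-<-trans (≤∣∣ _) (h i k k≤i ℕP.≤-refl))))
               (eq (seq r i) (seq r k) a)
    where
    eq : ∀ x y a → 4ℚ * a + 2ℚ + 1ℚ - 4ℚ * x ≡ 4ℚ * (a + ½ - y) + 4ℚ * (½ * ½ - (x - y))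
    eq = solve-∀ ring
  ... | inj₂ high = true , k , λ i k≤i →
          0≤-≡ (0≤4 ⊗ ≤⇒0≤- high ⊕ 0≤4 ⊗ ≤⇒0≤- (<⇒≤ (≤-<-trans (≤∣∣ _) (h k i ℕP.≤-refl k≤i))))
               (eq (seq r i) (seq r k) a)
    where
    eq : ∀ x y a → 4ℚ * x - (4ℚ * a + 1ℚ) ≡ 4ℚ * (y - (a + ½)) + 4ℚ * (½ * ½ - (y - x))
    eq = solve-∀ ring

  -- The 45° condition in coordinates

  Σℚ : ∀ {d} → (Fin d → ℚ) → ℚ
  Σℚ = foldr _+_ 0ℚ

  seq-· : ∀ {d} (v w : Point d) k → seq (v · w) k ≡ Σℚ (λ i → seq (v i) k * seq (w i) k)
  seq-· {ℕ.zero}  v w k = refl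
  seq-· {ℕ.suc d} v w k = cong (seq (v zero) k * seq (w zero) k +_) (seq-· (v ∘ suc) (w ∘ suc) k)

  Σℚ-0 : ∀ {d} (f : Fin d → ℚ) → (∀ i → f i ≡ 0ℚ) → Σℚ f ≡ 0ℚ
  Σℚ-0 {ℕ.zero}  f f≡0 = refl
  Σℚ-0 {ℕ.suc d} f f≡0 = cong₂ _+_ (f≡0 zero) (Σℚ-0 (f ∘ suc) (f≡0 ∘ suc))

  Σℚ-single : ∀ {d} (f : Fin d → ℚ) i → (∀ j → i ≢ j → f j ≡ 0ℚ) → Σℚ f ≡ f i
  Σℚ-single f zero    f≡0 = trans (cong (f zero +_) (Σℚ-0 (f ∘ suc) (λ j → f≡0 (suc j) λ ())))
      (+-identityʳ (f zero))
  Σℚ-single f (suc i) f≡0 = trans (cong₂ _+_ (f≡0 zero λ ()) (Σℚ-single (f ∘ suc) i λ j i≢j →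
      f≡0 (suc j) λ { refl → i≢j refl }))
    (+-identityˡ (f (suc i)))

  0≤Σℚ : ∀ {d} (f : Fin d → ℚ) → (∀ i → 0ℚ ≤ f i) → 0ℚ ≤ Σℚ f
  0≤Σℚ {ℕ.zero}  f 0≤f = ≤-refl
  0≤Σℚ {ℕ.suc d} f 0≤f = 0≤f zero ⊕ 0≤Σℚ (f ∘ suc) (0≤f ∘ suc)

  Σℚ-≥ : ∀ {d} (f : Fin d → ℚ) → (∀ i → 0ℚ ≤ f i) → ∀ i → f i ≤ Σℚ f
  Σℚ-≥ f 0≤f zero = subst (_≤ Σℚ f) (+-identityʳ (f zero)) (+-monoʳ-≤ (f zero) (0≤Σℚ (f ∘ suc) (0≤f ∘ suc)))
  Σℚ-≥ f 0≤f (suc i) = subst (_≤ Σℚ f) (+-identityˡ (f (suc i))) (+-mono-≤ (0≤f zero)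
      (Σℚ-≥ (f ∘ suc) (0≤f ∘ suc) i))

  Σℚ-≥₂ : ∀ {d} (f : Fin d → ℚ) → (∀ i → 0ℚ ≤ f i) → ∀ i j → i ≢ j → f i + f j ≤ Σℚ f
  Σℚ-≥₂ f 0≤f zero zero i≢j = ⊥-elim (i≢j refl)
  Σℚ-≥₂ f 0≤f zero (suc j) i≢j = +-monoʳ-≤ (f zero) (Σℚ-≥ (f ∘ suc) (0≤f ∘ suc) j)
  Σℚ-≥₂ f 0≤f (suc i) zero i≢j = subst (_≤ Σℚ f) (+-comm (f zero) (f (suc i)))
      (+-monoʳ-≤ (f zero) (Σℚ-≥ (f ∘ suc) (0≤f ∘ suc) i))
  Σℚ-≥₂ f 0≤f (suc i) (suc j) i≢j = subst (_≤ Σℚ f) (+-identityˡ (f (suc i) + f (suc j)))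
    (+-mono-≤ (0≤f zero) (Σℚ-≥₂ (f ∘ suc) (0≤f ∘ suc) i j (i≢j ∘ cong suc)))

  unit-same : ∀ {d} (i : Fin d) k → seq (unit i i) k ≡ 1ℚ
  unit-same i k with i ≟F i
  ... | yes _ = refl
  ... | no i≢i = ⊥-elim (i≢i refl)

  unit-other : ∀ {d} (i j : Fin d) k → i ≢ j → seq (unit i j) k ≡ 0ℚ
  unit-other i j k i≢j with i ≟F j
  ... | yes i≡j = ⊥-elim (i≢j i≡j)
  ... | no _ = refl

  -- With w = eᵢ the 45° condition reads |v|² ≤ 2 vᵢ².
  angle-bound : ∀ {d} (v : Point d) i side l → i ≢ l → AngleToLine≤45° v (normal (i , side)) →
    Eventually (λ k → 0ℚ ≤ seq (v i) k * seq (v i) k + 1ℚ - seq (v l) k * seq (v l) k)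
  angle-bound v i side l i≢l angle =
    ≤ℝ⇒ev {(v · v) *ℝ (w · w)} {fromℕ 2 *ℝ ((v · w) *ℝ (v · w))} angle (positive⁻¹ 1ℚ) ▹ bound
    where
    w = normal (i , side)
    bound : ∀ k → 0ℚ ≤ ι 2 * (seq (v · w) k * seq (v · w) k) + 1ℚ - seq (v · v) k * seq (w · w) k →
            0ℚ ≤ seq (v i) k * seq (v i) k + 1ℚ - seq (v l) k * seq (v l) k
    bound k h = 0≤-≡ (≤⇒0≤- v²≥ ⊕ subst₂ (λ p q → 0ℚ ≤ ι 2 * (p * p) + 1ℚ - seq (v · v) k * q) vw ww h)
        (eq (seq (v i) k) (seq (v l) k) (seq (v · v) k))
      where
      ww : seq (w · w) k ≡ 1ℚ
      ww = trans (seq-· (unit i) (unit i) k) (trans (Σℚ-single _ i λ j i≢j →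
          trans (cong₂ _*_ (unit-other i j k i≢j) (unit-other i j k i≢j)) refl)
        (cong₂ _*_ (unit-same i k) (unit-same i k)))
      vw : seq (v · w) k ≡ seq (v i) k
      vw = trans (seq-· v (unit i) k) (trans (Σℚ-single _ i λ j i≢j →
          trans (cong (seq (v j) k *_) (unit-other i j k i≢j)) (*-zeroʳ (seq (v j) k)))
        (trans (cong (seq (v i) k *_) (unit-same i k)) (*-identityʳ (seq (v i) k))))
      v²≥ : seq (v i) k * seq (v i) k + seq (v l) k * seq (v l) k ≤ seq (v · v) k
      v²≥ = subst (_ ≤_) (sym (seq-· v v k)) (Σℚ-≥₂ (λ j → seq (v j) k * seq (v j) k) (λ j → 0≤sq (seq (v j) k))
          i l i≢l)
      eq : ∀ p q s → p * p + 1ℚ - q * q ≡ (s - (p * p + q * q)) + (2ℚ * (p * p) + 1ℚ - s * 1ℚ)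
      eq = solve-∀ ring

  ι-drift≥ : ∀ u v W H → u ℕ.+ (W ℕ.+ H ℕ.+ 1) ℕ.≤ v → 0ℚ ≤ ι v - ι u - (ι W + ι H + 1ℚ)
  ι-drift≥ u v W H p = 0≤-≡ (ι-≤ p) (trans (eq (ι u) (ι v) (ι W) (ι H)) (cong (λ z → ι v - z) (sym
    (trans (ι-+ u (W ℕ.+ H ℕ.+ 1)) (cong (ι u +_) (trans (ι-+ (W ℕ.+ H) 1) (cong (_+ 1ℚ) (ι-+ W H))))))))
    where
    eq : ∀ u v W H → v - u - (W + H + 1ℚ) ≡ v - (u + (W + H + 1ℚ))
    eq = solve-∀ ring

  ι-drift≤ : ∀ u v W H h → 8 ℕ.* (v ℕ.+ (W ℕ.+ H ℕ.+ 1)) ℕ.≤ 8 ℕ.* u ℕ.+ h →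
    0ℚ ≤ ι h - 8ℚ * (ι v - ι u + (ι W + ι H + 1ℚ))
  ι-drift≤ u v W H h p = 0≤-≡ (ι-≤ p) (trans (eq (ι u) (ι v) (ι W) (ι H) (ι h)) (cong₂ _-_
    (sym (trans (ι-+ (8 ℕ.* u) h) (cong (_+ ι h) (ι-* 8 u))))
    (sym (trans (ι-* 8 (v ℕ.+ (W ℕ.+ H ℕ.+ 1))) (cong (8ℚ *_) (trans (ι-+ v (W ℕ.+ H ℕ.+ 1))
        (cong (ι v +_) (trans (ι-+ (W ℕ.+ H) 1) (cong (_+ 1ℚ) (ι-+ W H))))))))))
    where
    eq : ∀ u v W H h → h - 8ℚ * (v - u + (W + H + 1ℚ)) ≡ (8ℚ * u + h) - 8ℚ * (v + (W + H + 1ℚ))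
    eq = solve-∀ ring

  -- Cells with tolerance and the crossing of a lower cell

  onSide : Bool → ℕ → ℕ
  onSide s a = if s then ℕ.suc a else a

  onSide-≥ : ∀ s a → a ℕ.≤ onSide s a
  onSide-≥ false a = ℕP.≤-refl
  onSide-≥ true  a = ℕP.n≤1+n a

  onSide-≤ : ∀ s a → onSide s a ℕ.≤ ℕ.suc a
  onSide-≤ false a = ℕP.n≤1+n a
  onSide-≤ true  a = ℕP.≤-refl

  onSide-+ : ∀ s a b → onSide s (a ℕ.+ b) ≡ onSide s a ℕ.+ b
  onSide-+ false a b = refl
  onSide-+ true  a b = refl

  ι-suc : ∀ n → ι (ℕ.suc n) ≡ ι n + 1ℚ
  ι-suc n = trans (ι-+ 1 n) (+-comm 1ℚ (ι n))

  Near01 : ℚ → ℚ → Set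
  Near01 η x = 0ℚ ≤ x + η × 0ℚ ≤ 1ℚ + η - x

  NearCell : ℚ → ℕ → ℚ → Set
  NearCell η a y = 0ℚ ≤ y - ι a + η × 0ℚ ≤ ι a + 1ℚ + η - y

  near01 : ∀ x η → 0ℚ < η → fromℕ 0 ≤ℝ x → x ≤ℝ fromℕ 1 → Eventually (λ k → Near01 η (seq x k))
  near01 x η 0<η 0≤x x≤1 =
    (≤ℝ⇒ev {fromℕ 0} {x} 0≤x 0<η ▹ λ k p → 0≤-≡ p (eq (seq x k) η)) ∧ᵉ ≤ℝ⇒ev {x} {fromℕ 1} x≤1 0<η
    where
    eq : ∀ x η → x + η ≡ x + η - 0ℚ
    eq = solve-∀ ring

  nearCell : ∀ y η a → 0ℚ < η → fromℕ a ≤ℝ y → y ≤ℝ fromℕ (ℕ.suc a) → Eventually (λ k → NearCell η a (seq y k))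
  nearCell y η a 0<η a≤y y≤1+a =
    (≤ℝ⇒ev {fromℕ a} {y} a≤y 0<η ▹ λ k p → 0≤-≡ p (eq (seq y k) (ι a) η)) ∧ᵉ
    (≤ℝ⇒ev {y} {fromℕ (ℕ.suc a)} y≤1+a 0<η ▹ λ k q → 0≤-≡ q (cong (λ z → z + η - seq y k) (sym (ι-suc a))))
    where
    eq : ∀ y a η → y - a + η ≡ y + η - a
    eq = solve-∀ ring

  absurd : ∀ {p q} → 0ℚ ≤ p → 0ℚ ≤ q → p + q ≡ - 1ℚ → ⊥
  absurd 0≤p 0≤q eq = <-irrefl refl (<-≤-trans (negative⁻¹ (- 1ℚ)) (subst (0ℚ ≤_) eq (0≤p ⊕ 0≤q)))

  -- With tolerance 1 the increase along the axis is at most h + 3 in absolute value, whereas a ≥ h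
  -- + 7 would make the transverse one at least h + 4. But (h + 4)² exceeds (h + 3)² + 1.
  reach-at : ∀ {h a xi yi xl yl} → Near01 1ℚ xi → NearCell 1ℚ h yi → Near01 1ℚ xl → NearCell 1ℚ a yl →
    0ℚ ≤ (yi - xi) * (yi - xi) + 1ℚ - (yl - xl) * (yl - xl) → a ℕ.≤ h ℕ.+ 6
  reach-at {h} {a} {xi} {yi} {xl} {yl} (xi≥ , xi≤) (yi≥ , yi≤) (_ , xl≤) (yl≥ , _) sq with a ℕP.≤? h ℕ.+ 6
  ... | yes p = p
  ... | no ¬p = ⊥-elim (absurd (sq ⊕ v-u≥ ⊗ (v-u≥ ⊕ 0≤2 ⊗ (0≤ι h ⊕ 0≤4)) ⊕ p₁ ⊗ p₂) (0≤2 ⊗ 0≤ι h ⊕ (0≤4 ⊕ 0≤1))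
      (eq (ι h) (yi - xi) (yl - xl)))
    where
    7+h≤a : 0ℚ ≤ ι a - (ι h + (4ℚ + 2ℚ + 1ℚ))
    7+h≤a = subst (λ z → 0ℚ ≤ ι a - z) (trans (cong ι (trans (ℕP.+-comm 1 (h ℕ.+ 6)) (ℕP.+-assoc h 6 1)))
        (ι-+ h 7)) (ι-≤ (ℕP.≰⇒> ¬p))
    v-u≥ : 0ℚ ≤ (yl - xl) - (ι h + 4ℚ)
    v-u≥ = 0≤-≡ (7+h≤a ⊕ yl≥ ⊕ xl≤) (e (ι a) (ι h) xl yl)
      where
      e : ∀ a h x y → (y - x) - (h + 4ℚ) ≡ (a - (h + (4ℚ + 2ℚ + 1ℚ))) + (y - a + 1ℚ) + (1ℚ + 1ℚ - x)
      e = solve-∀ ring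
    p₁ : 0ℚ ≤ (ι h + 2ℚ + 1ℚ) - (yi - xi)
    p₁ = 0≤-≡ (xi≥ ⊕ yi≤) (e (ι h) xi yi)
      where
      e : ∀ h x y → (h + 2ℚ + 1ℚ) - (y - x) ≡ (x + 1ℚ) + (h + 1ℚ + 1ℚ - y)
      e = solve-∀ ring
    p₂ : 0ℚ ≤ (ι h + 2ℚ + 1ℚ) + (yi - xi)
    p₂ = 0≤-≡ (xi≤ ⊕ yi≥ ⊕ 0≤2 ⊗ 0≤ι h) (e (ι h) xi yi)
      where
      e : ∀ h x y → (h + 2ℚ + 1ℚ) + (y - x) ≡ (1ℚ + 1ℚ - x) + (y - h + 1ℚ) + 2ℚ * h
      e = solve-∀ ring
    eq : ∀ h u v → (u * u + 1ℚ - v * v) + (v - (h + 4ℚ)) * ((v - (h + 4ℚ)) + 2ℚ * (h + 4ℚ))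
        + ((h + 2ℚ + 1ℚ) - u) * ((h + 2ℚ + 1ℚ) + u)
         + (2ℚ * h + (4ℚ + 1ℚ)) ≡ - 1ℚ
    eq = solve-∀ ring

  Speed : ℚ → ℕ → ℚ → Set
  Speed η h Y = 0ℚ ≤ Y - (ι h - 1ℚ - 2ℚ * η) × 0ℚ ≤ ι h + 1ℚ + 2ℚ * η - Y

  speed : ∀ {η h x y} → Near01 η x → NearCell η h y → Speed η h (y - x)
  speed {η} {h} {x} {y} (x≥ , x≤) (y≥ , y≤) = 0≤-≡ (x≤ ⊕ y≥) (e₁ x y η (ι h)) , 0≤-≡ (x≥ ⊕ y≤) (e₂ x y η (ι h))
    where
    e₁ : ∀ x y η h → (y - x) - (h - 1ℚ - 2ℚ * η) ≡ (1ℚ + η - x) + (y - h + η)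
    e₁ = solve-∀ ring
    e₂ : ∀ x y η h → h + 1ℚ + 2ℚ * η - (y - x) ≡ (x + η) + (h + 1ℚ + η - y)
    e₂ = solve-∀ ring

  InHalf : Bool → ℕ → ℚ → Set
  InHalf b a y = if b then 0ℚ ≤ 4ℚ * y - (4ℚ * ι a + 1ℚ) else 0ℚ ≤ 4ℚ * ι a + 2ℚ + 1ℚ - 4ℚ * y

  -- A segment ending in the high half of a cell is reflected in that coordinate.
  crossing : ∀ {x y Y I η} h H a a′ W h′ → ∀ b → h ≡ h′ ℕ.+ H → a ≡ a′ ℕ.+ W →
    Y * I ≡ 1ℚ → 0ℚ ≤ I → 0ℚ ≤ η → 0ℚ ≤ 1ℚ - 4ℚ * η * ι h →
    Near01 η x → NearCell η a y → InHalf b a y → Speed η h Y → Passes b H W h a h′ a′ →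
    0ℚ ≤ (x + (1ℚ - ι H * I) * (y - x)) - ι a′ × 0ℚ ≤ ι (ℕ.suc a′) - (x + (1ℚ - ι H * I) * (y - x))
  crossing {x} {y} {Y} {I} {η} h H a a′ W h′ b refl refl YI 0≤I 0≤η η≤ (x≥ , x≤) (y≥ , y≤) half (Y≥ , Y≤) passes =
    go b half passes
    where
    A-A′ : ι (a′ ℕ.+ W) - ι a′ ≡ ι W
    A-A′ = trans (cong (_- ι a′) (ι-+ a′ W)) (e (ι a′) (ι W))
      where
      e : ∀ a w → (a + w) - a ≡ w
      e = solve-∀ ring
    2W : 0ℚ ≤ ι W + ι W
    2W = 0≤ι W ⊕ 0≤ι W
    0≤p-p : ∀ p → 0ℚ ≤ p - p
    0≤p-p p = ≤-reflexive (sym (+-inverseʳ p))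
    drift : ι h * (ι a - ι a′) - ι H * ι a ≡ ι (h′ ℕ.* a) - ι (h ℕ.* a′)
    drift = trans (cong (λ z → z * (ι a - ι a′) - ι H * ι a) (ι-+ h′ H)) (trans (e (ι h′) (ι H) (ι a) (ι a′))
      (sym (cong₂ _-_ (ι-* h′ a) (trans (ι-* h a′) (cong (_* ι a′) (ι-+ h′ H))))))
      where
      e : ∀ h′ H a a′ → (h′ + H) * (a - a′) - H * a ≡ h′ * a - (h′ + H) * a′
      e = solve-∀ ring
    drift⁻ : ι h * (- ι a - - ι a′) - ι H * (- ι a) ≡ ι (h ℕ.* a′) - ι (h′ ℕ.* a)
    drift⁻ = trans (e₁ (ι h) (ι H) (ι a) (ι a′)) (trans (cong -_ drift) (e₂ (ι (h′ ℕ.* a)) (ι (h ℕ.* a′))))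
      where
      e₁ : ∀ h H a a′ → h * (- a - - a′) - H * (- a) ≡ - (h * (a - a′) - H * a)
      e₁ = solve-∀ ring
      e₂ : ∀ p q → - (p - q) ≡ q - p
      e₂ = solve-∀ ring
    go : ∀ b → InHalf b a y → Passes b H W h a h′ a′ →
      0ℚ ≤ (x + (1ℚ - ι H * I) * (y - x)) - ι a′ × 0ℚ ≤ ι (ℕ.suc a′) - (x + (1ℚ - ι H * I) * (y - x))
    go false half (c₁ , c₂) = lower , subst (λ z → 0ℚ ≤ z - (x + (1ℚ - ι H * I) * (y - x))) (sym (ι-suc a′)) upper
      where
      open Crossing x y Y I (ι h) (ι H) (ι a) (ι a′) (ι W) η YI 0≤I (0≤ι H) (0≤ι W) 0≤η η≤ x≥ x≤ y≥ y≤ half Y≥ Y≤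
        (subst (λ z → 0ℚ ≤ ι W + z) (sym A-A′) 2W) (subst (λ z → 0ℚ ≤ ι W - z) (sym A-A′) (0≤p-p (ι W)))
        (subst (λ z → 0ℚ ≤ z - (ι W + ι H + 1ℚ)) (sym drift) (ι-drift≥ (h ℕ.* a′) (h′ ℕ.* a) W H c₁))
        (subst (λ z → 0ℚ ≤ ι h - 8ℚ * (z + (ι W + ι H + 1ℚ))) (sym drift) (ι-drift≤ (h ℕ.* a′) (h′ ℕ.* a) W H h
            c₂))
    go true half (c₁ , c₂) = 0≤-≡ upper (e₁ x y (ι H) I (ι a′)) , 0≤-≡ lower
        (trans (cong (_- (x + (1ℚ - ι H * I) * (y - x))) (ι-suc a′)) (e₂ x y (ι H) I (ι a′)))
      where
      e₁ : ∀ x y H I a → (x + (1ℚ - H * I) * (y - x)) - a ≡ - a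
          + 1ℚ - ((1ℚ - x) + (1ℚ - H * I) * ((1ℚ - y) - (1ℚ - x)))
      e₁ = solve-∀ ring
      e₂ : ∀ x y H I a → a + 1ℚ - (x + (1ℚ - H * I) * (y - x)) ≡
          ((1ℚ - x) + (1ℚ - H * I) * ((1ℚ - y) - (1ℚ - x))) - - a
      e₂ = solve-∀ ring
      f₁ : ∀ x η → (1ℚ - x) + η ≡ 1ℚ + η - x
      f₁ = solve-∀ ring
      f₂ : ∀ x η → 1ℚ + η - (1ℚ - x) ≡ x + η
      f₂ = solve-∀ ring
      f₃ : ∀ y a η → (1ℚ - y) - - a + η ≡ a + 1ℚ + η - y
      f₃ = solve-∀ ring
      f₄ : ∀ y a η → - a + 1ℚ + η - (1ℚ - y) ≡ y - a + η
      f₄ = solve-∀ ring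
      f₅ : ∀ y a → 4ℚ * (- a) + 2ℚ + 1ℚ - 4ℚ * (1ℚ - y) ≡ 4ℚ * y - (4ℚ * a + 1ℚ)
      f₅ = solve-∀ ring
      g₁ : ∀ w a b → w + (- a - - b) ≡ w - (a - b)
      g₁ = solve-∀ ring
      g₂ : ∀ w a b → w - (- a - - b) ≡ w + (a - b)
      g₂ = solve-∀ ring
      open Crossing (1ℚ - x) (1ℚ - y) Y I (ι h) (ι H) (- ι a) (- ι a′) (ι W) η YI 0≤I (0≤ι H) (0≤ι W) 0≤η η≤
        (0≤-≡ x≤ (f₁ x η)) (0≤-≡ x≥ (f₂ x η)) (0≤-≡ y≤ (f₃ y (ι a) η)) (0≤-≡ y≥ (f₄ y (ι a) η))
            (0≤-≡ half (f₅ y (ι a))) Y≥ Y≤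
        (0≤-≡ (0≤p-p (ι W)) (trans (g₁ (ι W) (ι a) (ι a′)) (cong (λ z → ι W - z) A-A′)))
        (0≤-≡ 2W (trans (g₂ (ι W) (ι a) (ι a′)) (cong (ι W +_) A-A′)))
        (subst (λ z → 0ℚ ≤ z - (ι W + ι H + 1ℚ)) (sym drift⁻) (ι-drift≥ (h′ ℕ.* a) (h ℕ.* a′) W H c₁))
        (subst (λ z → 0ℚ ≤ ι h - 8ℚ * (z + (ι W + ι H + 1ℚ))) (sym drift⁻) (ι-drift≤ (h′ ℕ.* a) (h ℕ.* a′) W H h
            c₂))

  -- A condition on corners alone that suffices for blocking. The bound 2 ≤ a′ i puts the crossing
  -- point after the start of the segment, wherever in the observer it starts.
  Hidden : ∀ {d} → Fin d → (Fin d → Bool) → (a a′ : Fin d → ℕ) → ℕ → Set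
  Hidden i σ a a′ H = a i ≡ a′ i ℕ.+ H × 1 ℕ.≤ H × 2 ℕ.≤ a′ i ×
    (∀ l → i ≢ l → ∃[ W ] a l ≡ a′ l ℕ.+ W × Passes (σ l) H W (a i) (a l) (a′ i) (a′ l))

  0<4ι : ∀ h → 2 ℕ.≤ h → 0ℚ < 4ℚ * ι h
  0<4ι h 2≤h = <-≤-trans (positive⁻¹ 8ℚ) (0≤-⇒≤ (0≤-≡ (0≤4 ⊗ ι-≤ 2≤h) (eq (ι h))))
    where
    eq : ∀ h → 4ℚ * h - 8ℚ ≡ 4ℚ * (h - 2ℚ)
    eq = solve-∀ ring

  -- A line of sight and the lower cubes that block it

  module Segment {d n} (Q : Cube d n) (x y : Point d) (i : Fin d) (side : Bool)
    (x∈ : InUnitCubeAt (origin {d}) x) (y∈ : OnFacet Q (i , side) y)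
    (angle : AngleToLine≤45° (x ⟶ y) (normal (i , side))) where

    a : Fin d → ℕ
    a = corner Q

    reach-≢ : ∀ l → i ≢ l → a l ℕ.≤ a i ℕ.+ 6
    reach-≢ l i≢l = at k (proj₂ e k ℕP.≤-refl)
      where
      0<1 : 0ℚ < 1ℚ
      0<1 = positive⁻¹ 1ℚ
      ex : ∀ l → Eventually (λ k → Near01 1ℚ (seq (x l) k))
      ex l = near01 (x l) 1ℚ 0<1 (proj₁ (x∈ l)) (proj₂ (x∈ l))
      ey : ∀ l → Eventually (λ k → NearCell 1ℚ (a l) (seq (y l) k))
      ey l = nearCell (y l) 1ℚ (a l) 0<1 (proj₁ (proj₁ y∈ l)) (proj₂ (proj₁ y∈ l))
      e : Eventually _
      e = (ex i ∧ᵉ ey i) ∧ᵉ (ex l ∧ᵉ ey l) ∧ᵉ angle-bound (x ⟶ y) i side l i≢l angle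
      k : ℕ
      k = proj₁ e
      at : ∀ k → ((Near01 1ℚ (seq (x i) k) × NearCell 1ℚ (a i) (seq (y i) k)) × (Near01 1ℚ (seq (x l) k) ×
          NearCell 1ℚ (a l) (seq (y l) k)) ×
        0ℚ ≤ (seq (y i) k - seq (x i) k) * (seq (y i) k - seq (x i) k) + 1ℚ - (seq (y l) k - seq (x l) k) * (seq
            (y l) k - seq (x l) k)) → a l ℕ.≤ a i ℕ.+ 6
      at k ((p₁ , p₂) , (p₃ , p₄) , p₅) = reach-at {a i} {a l} {seq (x i) k} {seq (y i) k} {seq (x l) k}
          {seq (y l) k} p₁ p₂ p₃ p₄ p₅

    reach : ∀ l → a l ℕ.≤ a i ℕ.+ 6
    reach l = cases (i ≟F l)
      where
      cases : Dec (i ≡ l) → a l ℕ.≤ a i ℕ.+ 6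
      cases (yes i≡l) = subst (λ j → a j ℕ.≤ a i ℕ.+ 6) i≡l (ℕP.m≤m+n (a i) 6)
      cases (no i≢l)  = reach-≢ l i≢l

    half : ∀ l → ∃[ b ] Eventually (λ k → InHalf b (a l) (seq (y l) k))
    half l = cases (halfway (y l) (ι (a l)))
      where
      cases : ∃[ b ] (if b then Eventually (λ i → 0ℚ ≤ 4ℚ * seq (y l) i - (4ℚ * ι (a l) + 1ℚ))
                 else Eventually (λ i → 0ℚ ≤ 4ℚ * ι (a l) + 2ℚ + 1ℚ - 4ℚ * seq (y l) i)) →
                     ∃[ b ] Eventually (λ k → InHalf b (a l) (seq (y l) k))
      cases (false , e) = false , e
      cases (true , e) = true , e

    module _ (Q′ : Cube d n) (H : ℕ) (hidden : Hidden i (proj₁ ∘ half) a (corner Q′) H) where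

      a′ : Fin d → ℕ
      a′ = corner Q′
      h h′ c c′ : ℕ
      h = a i
      h′ = a′ i
      c = onSide side h
      c′ = onSide side h′

      h≡ : h ≡ h′ ℕ.+ H
      h≡ = proj₁ hidden

      1≤H : 1 ℕ.≤ H
      1≤H = proj₁ (proj₂ hidden)

      2≤h′ : 2 ℕ.≤ h′
      2≤h′ = proj₁ (proj₂ (proj₂ hidden))

      2≤h : 2 ℕ.≤ h
      2≤h = ℕP.≤-trans 2≤h′ (subst (h′ ℕ.≤_) (sym h≡) (ℕP.m≤m+n h′ H))

      -- The tolerance is 1/(4h): it must shrink with h, since in `Crossing` it is multiplied by Y,
      -- which is about h.
      quot : ∃[ δ ] 0ℚ < δ × 4ℚ * ι h * δ ≡ 1ℚ
      quot = quotient (4ℚ * ι h) 1ℚ (0<4ι h 2≤h) (positive⁻¹ 1ℚ)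

      η : ℚ
      η = proj₁ quot
      0<η : 0ℚ < η
      0<η = proj₁ (proj₂ quot)
      0≤η : 0ℚ ≤ η
      0≤η = <⇒≤ 0<η
      4hη≡1 : 4ℚ * ι h * η ≡ 1ℚ
      4hη≡1 = proj₂ (proj₂ quot)

      4ηh≤1 : 0ℚ ≤ 1ℚ - 4ℚ * η * ι h
      4ηh≤1 = ≤-reflexive (trans (sym (+-inverseʳ 1ℚ)) (cong (λ z → 1ℚ - z) (trans (sym 4hη≡1) (eq (ι h) η))))
        where
        eq : ∀ h η → 4ℚ * h * η ≡ 4ℚ * η * h
        eq = solve-∀ ring

      8η≤1 : 0ℚ ≤ 1ℚ - 8ℚ * η
      8η≤1 = 0≤-≡ (0≤4 ⊗ 0≤η ⊗ ι-≤ 2≤h ⊕ 4ηh≤1) (eq (ι h) η)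
        where
        eq : ∀ h η → 1ℚ - 8ℚ * η ≡ 4ℚ * η * (h - 2ℚ) + (1ℚ - 4ℚ * η * h)
        eq = solve-∀ ring

      Y : ℕ → ℚ
      Y k = seq (y i) k - seq (x i) k

      near-x : ∀ l → Eventually (λ k → Near01 η (seq (x l) k))
      near-x l = near01 (x l) η 0<η (proj₁ (x∈ l)) (proj₂ (x∈ l))

      near-y : ∀ l → Eventually (λ k → NearCell η (a l) (seq (y l) k))
      near-y l = nearCell (y l) η (a l) 0<η (proj₁ (proj₁ y∈ l)) (proj₂ (proj₁ y∈ l))

      speedᵉ : Eventually (λ k → Speed η h (Y k))
      speedᵉ = near-x i ∧ᵉ near-y i ▹ λ k (p , q) → speed {η} {h} {seq (x i) k} {seq (y i) k} p q

      H+1≤Y+2η : ∀ k → Speed η h (Y k) → 0ℚ ≤ Y k - (ι H + 1ℚ - 2ℚ * η)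
      H+1≤Y+2η k (p , _) = 0≤-≡ (p ⊕ ι-≤ 2≤h′) (trans (eq (Y k) (ι h′) (ι H) η)
          (cong (λ z → (Y k - (z - 1ℚ - 2ℚ * η)) + (ι h′ - ι 2)) (sym (trans (cong ι h≡) (ι-+ h′ H)))))
        where
        eq : ∀ Y h′ H η → Y - (H + 1ℚ - 2ℚ * η) ≡ (Y - (h′ + H - 1ℚ - 2ℚ * η)) + (h′ - 2ℚ)
        eq = solve-∀ ring

      H≤Y : ∀ k → Speed η h (Y k) → 0ℚ ≤ Y k - ι H
      H≤Y k s = 0≤-≡ (H+1≤Y+2η k s ⊕ 8η≤1 ⊕ (0≤4 ⊕ 0≤2) ⊗ 0≤η) (eq (Y k) (ι H) η)
        where
        eq : ∀ Y H η → Y - H ≡ (Y - (H + 1ℚ - 2ℚ * η)) + (1ℚ - 8ℚ * η) + (4ℚ + 2ℚ) * η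
        eq = solve-∀ ring

      1≤Y : ∀ k → Speed η h (Y k) → 0ℚ ≤ Y k - 1ℚ
      1≤Y k s = 0≤-≡ (H≤Y k s ⊕ ι-≤ 1≤H) (eq (Y k) (ι H))
        where
        eq : ∀ Y H → Y - 1ℚ ≡ (Y - H) + (H - 1ℚ)
        eq = solve-∀ ring

      1/Y : ℝ
      1/Y = mkℝ (inv ∘ Y) (inv-cauchy {Y} (cauchy ((x ⟶ y) i)) (speedᵉ ▹ 1≤Y))

      -- At 1 - H/Y the axis coordinate is exactly H below its final value, so the point lies in the
      -- plane of the corresponding facet of `Q′`.
      t : ℝ
      t = 1ℝ -ℝ fromℕ H *ℝ 1/Y

      0≤t : 0ℝ ≤ℝ t
      0≤t = ev⇒≤ℝ {0ℝ} {t} (speedᵉ ▹ λ k s → 0≤-≡ (0≤inv (Y k) (1≤Y k s) ⊗ H≤Y k s)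
        (trans (cong (λ z → z - ι H * inv (Y k) - 0ℚ) (sym (*-inv (Y k) (1≤Y k s))))
            (eq (Y k) (ι H) (inv (Y k)))))
        where
        eq : ∀ Y H I → Y * I - H * I - 0ℚ ≡ I * (Y - H)
        eq = solve-∀ ring

      quot₂ : ∃[ δ ] 0ℚ < δ × (ι h + 2ℚ) * δ ≡ 1ℚ
      quot₂ = quotient (ι h + 2ℚ) 1ℚ (<-≤-trans (positive⁻¹ 2ℚ) (0≤-⇒≤ (0≤-≡ (0≤ι h) (eq (ι h))))) (positive⁻¹ 1ℚ)
        where
        eq : ∀ h → (h + 2ℚ) - 2ℚ ≡ h
        eq = solve-∀ ring

      t<1 : t <ℝ 1ℝ
      -- The gap δ is 1/(h + 2), a lower bound for H/Y because H ≥ 1 and Y ≤ h + 1 + 2η ≤ h + 2.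
      t<1 = δ , proj₁ (proj₂ quot₂) , (speedᵉ ▹ λ k s → 0≤-⇒≤ (below k s))
        where
        δ : ℚ
        δ = proj₁ quot₂
        0≤δ : 0ℚ ≤ δ
        0≤δ = <⇒≤ (proj₁ (proj₂ quot₂))
        below : ∀ k → Speed η h (Y k) → 0ℚ ≤ 1ℚ - (1ℚ - ι H * inv (Y k) + δ)
        below k s = 0≤-≡ (0≤inv (Y k) (1≤Y k s) ⊗ 0≤δ ⊗ (proj₂ s ⊕ 8η≤1 ⊕ (0≤4 ⊕ 0≤2) ⊗ 0≤η) ⊕ 0≤inv (Y k)
            (1≤Y k s) ⊗ ι-≤ 1≤H)
          (begin
            1ℚ - (1ℚ - ι H * I + δ)               ≡⟨ e₁ (ι H) I δ ⟩
            ι H * I - 1ℚ * δ                       ≡⟨ cong (λ z → ι H * I - z * δ) (sym (*-inv (Y k) (1≤Y k s))) ⟩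
            ι H * I - Y k * I * δ                  ≡⟨ e₂ (ι H) I δ (Y k) (ι h) ⟩
            I * (ι H) + I * (δ * (ι h + 2ℚ - Y k)) - I * ((ι h + 2ℚ) * δ)
                                                   ≡⟨ cong (λ z → I * (ι H) + I * (δ * (ι h + 2ℚ - Y k)) - I * z)
                                                       (proj₂ (proj₂ quot₂)) ⟩
            I * (ι H) + I * (δ * (ι h + 2ℚ - Y k)) - I * 1ℚ
                                                   ≡⟨ e₃ (ι H) I δ (Y k) (ι h) η ⟩
            I * δ * ((ι h + 1ℚ + 2ℚ * η - Y k) + (1ℚ - 8ℚ * η) + (4ℚ + 2ℚ) * η) + I * (ι H - 1ℚ) ∎)
          where
          open ≡-Reasoning
          I : ℚ
          I = inv (Y k)
          e₁ : ∀ H I δ → 1ℚ - (1ℚ - H * I + δ) ≡ H * I - 1ℚ * δ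
          e₁ = solve-∀ ring
          e₂ : ∀ H I δ Y h → H * I - Y * I * δ ≡ I * H + I * (δ * (h + 2ℚ - Y)) - I * ((h + 2ℚ) * δ)
          e₂ = solve-∀ ring
          e₃ : ∀ H I δ Y h η → I * H + I * (δ * (h + 2ℚ - Y)) - I * 1ℚ ≡
               I * δ * ((h + 1ℚ + 2ℚ * η - Y) + (1ℚ - 8ℚ * η) + (4ℚ + 2ℚ) * η) + I * (H - 1ℚ)
          e₃ = solve-∀ ring

      p : Point d
      p = along x y t

      at-i : ∀ k → Speed η h (Y k) → seq (p i) k ≡ seq (y i) k - ι H
      at-i k s = trans (e₁ (seq (x i) k) (seq (y i) k) (ι H) (inv (Y k)))
          (trans (cong (λ z → seq (y i) k - ι H * z) (*-inv (Y k) (1≤Y k s)))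
        (cong (λ z → seq (y i) k - z) (*-identityʳ (ι H))))
        where
        e₁ : ∀ x y H I → x + (1ℚ - H * I) * (y - x) ≡ y - H * ((y - x) * I)
        e₁ = solve-∀ ring

      c≡ : ι c ≡ ι c′ + ι H
      c≡ = trans (cong ι (trans (cong (onSide side) h≡) (onSide-+ side h′ H))) (ι-+ c′ H)

      onPlane : p i ≈ℝ fromℕ c′
      onPlane = (λ ε 0<ε → ≤ℝ⇒ev {y i} {fromℕ c} (proj₁ (proj₂ y∈)) 0<ε ∧ᵉ speedᵉ ▹ λ k (q , s) →
                   0≤-⇒≤ (0≤-≡ q (trans (cong (λ z → ι c′ + ε - z) (at-i k s))
                   (trans (e₁ (ι c′) ε (seq (y i) k) (ι H)) (cong (λ z → z + ε - seq (y i) k) (sym c≡))))))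
              , (λ ε 0<ε → ≤ℝ⇒ev {fromℕ c} {y i} (proj₂ (proj₂ y∈)) 0<ε ∧ᵉ speedᵉ ▹ λ k (q , s) →
                   0≤-⇒≤ (0≤-≡ q (trans (cong (λ z → z + ε - ι c′) (at-i k s))
                   (trans (e₂ (ι c′) ε (seq (y i) k) (ι H)) (cong (λ z → seq (y i) k + ε - z) (sym c≡))))))
        where
        e₁ : ∀ c ε y H → c + ε - (y - H) ≡ c + H + ε - y
        e₁ = solve-∀ ring
        e₂ : ∀ c ε y H → y - H + ε - c ≡ y + ε - (c + H)
        e₂ = solve-∀ ring

      ≤ℝ-trans : ∀ {u v w} → u ≤ℝ v → v ≤ℝ w → u ≤ℝ w
      ≤ℝ-trans {u} {v} {w} u≤v v≤w ε 0<ε = u≤v (½ * ε) (half-pos 0<ε) ∧ᵉ v≤w (½ * ε) (half-pos 0<ε)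
          ▹ λ k (q , r) → ≤-trans q
          (≤-trans (+-monoˡ-≤ (½ * ε) r) (≤-reflexive (trans (+-assoc (seq w k) (½ * ε) (½ * ε))
              (cong (seq w k +_) (halves ε)))))

      fromℕ-≤ : ∀ {m n} → m ℕ.≤ n → fromℕ m ≤ℝ fromℕ n
      fromℕ-≤ {m} {n} m≤n = ev⇒≤ℝ {fromℕ m} {fromℕ n} (0 , λ _ _ → ι-≤ m≤n)

      inCube : ∀ l → fromℕ (a′ l) ≤ℝ p l × p l ≤ℝ fromℕ (ℕ.suc (a′ l))
      inCube l = cases (i ≟F l)
        where
        crossᵉ : i ≢ l → Eventually (λ k → 0ℚ ≤ seq (p l) k - ι (a′ l) × 0ℚ ≤ ι (ℕ.suc (a′ l)) - seq (p l) k)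
        crossᵉ i≢l = speedᵉ ∧ᵉ near-x l ∧ᵉ near-y l ∧ᵉ proj₂ (half l) ▹ λ k (s , px , py , ph) →
          crossing {seq (x l) k} {seq (y l) k} {Y k} {inv (Y k)} {η} h H (a l) (a′ l) (proj₁ (W i≢l)) h′
              (proj₁ (half l)) h≡ (proj₁ (proj₂ (W i≢l)))
                         (*-inv (Y k) (1≤Y k s)) (0≤inv (Y k) (1≤Y k s)) 0≤η 4ηh≤1 px py ph s
                             (proj₂ (proj₂ (W i≢l)))
          where
          W = proj₂ (proj₂ (proj₂ hidden)) l
        cases : Dec (i ≡ l) → fromℕ (a′ l) ≤ℝ p l × p l ≤ℝ fromℕ (ℕ.suc (a′ l))
        cases (yes i≡l) = subst (λ j → fromℕ (a′ j) ≤ℝ p j × p j ≤ℝ fromℕ (ℕ.suc (a′ j))) i≡l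
          ( ≤ℝ-trans {fromℕ h′} {fromℕ c′} {p i} (fromℕ-≤ (onSide-≥ side h′)) (proj₂ onPlane)
          , ≤ℝ-trans {p i} {fromℕ c′} {fromℕ (ℕ.suc h′)} (proj₁ onPlane) (fromℕ-≤ (onSide-≤ side h′)))
        cases (no i≢l) = ev⇒≤ℝ {fromℕ (a′ l)} {p l} (crossᵉ i≢l ▹ λ _ → proj₁)
                       , ev⇒≤ℝ {p l} {fromℕ (ℕ.suc (a′ l))} (crossᵉ i≢l ▹ λ _ → proj₂)

      -- The facet crossed has the same axis and side as the facet seen, so the same normal, and the
      -- angle hypothesis carries over unchanged.
      blocks : BlocksBefore Q′ x y
      blocks = (i , side) , t , 0≤t , t<1 , (inCube , onPlane) , angle

  visible⇒unhidden : ∀ {d n} (O : Pred (Cube d n) 0ℓ) Q → Visible O Q →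
    ∃[ i ] ∃[ σ ] (∀ l → corner Q l ℕ.≤ corner Q i ℕ.+ 6) ×
      (∀ Q′ → Q′ ∈ O → ∀ H → ¬ Hidden i σ (corner Q) (corner Q′) H)
  visible⇒unhidden O Q (x , y , (i , side) , x∈ , y∈ , _ , angle , free) =
    i , proj₁ ∘ half , reach , λ Q′ Q′∈O H hid → free Q′ Q′∈O (λ Q′≡Q →
        self (subst (λ P → Hidden i (proj₁ ∘ half) (corner Q) (corner P) H) Q′≡Q hid)) (blocks Q′ H hid)
    where
    open Segment Q x y i side x∈ y∈ angle
    -- Supplies `Q′ ≢ Q`: a hiding cube is strictly lower along the axis.
    self : ∀ {H} → ¬ Hidden i (proj₁ ∘ half) (corner Q) (corner Q) H
    self {H} (h≡ , 1≤H , _) = ℕP.<⇒≢ (ℕP.≤-trans (ℕP.≤-reflexive (ℕP.+-comm 1 (corner Q i)))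
        (ℕP.+-monoʳ-≤ (corner Q i) 1≤H)) h≡

-- The choice of L and the final estimate

module Bound where

  open import Data.Bool using (Bool)
  open import Data.Fin as F using (Fin; punchIn; punchOut)
  import Data.Fin.Properties as F
  open import Data.List as List using (List; _∷_; length)
  open import Data.List.Membership.Propositional.Properties using (∈-lookup)
  open import Data.List.Relation.Unary.All as All using (All; _∷_)
  open import Data.List.Relation.Unary.AllPairs using (_∷_)
  open import Data.List.Relation.Unary.Unique.Propositional using (Unique)
  open import Data.Nat
  open import Data.Nat.DivMod
  open import Data.Nat.Properties
  open import Data.Nat.Tactic.RingSolver using (solve-∀)
  open import Data.Product
  import Data.Vec as Vec
  open import Data.Vec.Properties using (tabulate∘lookup; tabulate-cong)
  open import Function using (_∘_)
  open import Level using (0ℓ)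
  open import Relation.Binary.PropositionalEquality
  open import Relation.Nullary
  open import Relation.Unary using (Pred; _∈_)
  open Counting
  open Rays using (Hidden; visible⇒unhidden)

  *-^-distrib : ∀ k x y → (x * y) ^ k ≡ x ^ k * y ^ k
  *-^-distrib zero    x y = refl
  *-^-distrib (suc k) x y = trans (cong (x * y *_) (*-^-distrib k x y)) (e x y (x ^ k) (y ^ k))
    where
    e : ∀ x y u v → x * y * (u * v) ≡ x * u * (y * v)
    e = solve-∀

  nth-root : ∀ d .{{_ : NonZero d}} n → ∃[ L₀ ] suc L₀ ^ d ≤ suc n × suc n < suc (suc L₀) ^ d
  nth-root d zero = 0 , ≤-reflexive (^-zeroˡ d) , subst (_< 2 ^ d) (^-zeroˡ d) (^-monoˡ-< d ≤-refl)
  nth-root d (suc n) with nth-root d n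
  ... | L₀ , lo , hi with suc (suc n) <? suc (suc L₀) ^ d
  ... | yes hi′ = L₀ , ≤-trans lo (n≤1+n (suc n)) , hi′
  ... | no ¬hi′ = suc L₀ , ≮⇒≥ ¬hi′ , ≤-<-trans hi (^-monoˡ-< d ≤-refl)

  -- Each of the m + 1 factors is of order n / L, and n < (L + 1)^(m+1) ≤ (2L)^(m+1) cancels L^(m+1)
  -- against one power of n.
  rises×codes≤ : ∀ m n L₀ → suc L₀ ^ suc m ≤ n → n < suc (suc L₀) ^ suc m → .{{_ : NonZero n}} →
    suc (n / suc L₀) * suc ((98 * n) / suc L₀) ^ m ≤ 2 * 196 ^ m * 2 ^ suc m * n ^ m
  rises×codes≤ m n L₀ lo hi = begin
    suc M * suc ((98 * n) / L) ^ m       ≤⟨ *-monoʳ-≤ (suc M) (^-monoˡ-≤ m Z₄≤) ⟩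
    suc M * (196 * M) ^ m                ≤⟨ *-monoˡ-≤ _ (lin (suc M) (2 * M) 0 1≤M (e₀ M)) ⟩
    2 * M * (196 * M) ^ m                ≡⟨ cong (2 * M *_) (*-^-distrib m 196 M) ⟩
    2 * M * (196 ^ m * M ^ m)            ≡⟨ e₁ M (196 ^ m) (M ^ m) ⟩
    2 * 196 ^ m * (M * M ^ m)            ≤⟨ *-monoʳ-≤ (2 * 196 ^ m) M^d≤ ⟩
    2 * 196 ^ m * (2 ^ suc m * n ^ m)    ≡⟨ *-assoc (2 * 196 ^ m) (2 ^ suc m) (n ^ m) ⟨
    2 * 196 ^ m * 2 ^ suc m * n ^ m      ∎
    where
    open ≤-Reasoning
    L M : ℕ
    L = suc L₀
    M = n / L
    e₀ : ∀ M → suc M + M + 0 ≡ 2 * M + 1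
    e₀ = solve-∀
    e₁ : ∀ M x y → 2 * M * (x * y) ≡ 2 * x * (M * y)
    e₁ = solve-∀
    L≤n : L ≤ n
    L≤n = ≤-trans (≤-trans (≤-reflexive (sym (*-identityʳ L))) (*-monoʳ-≤ L (m^n>0 L m))) lo
    1≤M : 1 ≤ M
    1≤M = m≥n⇒m/n>0 L≤n
    n<LM+L : n < suc M * L
    n<LM+L = begin-strict
      n                    ≡⟨ m≡m%n+[m/n]*n n L ⟩
      n % L + M * L        <⟨ +-monoˡ-< (M * L) (m%n<n n L) ⟩
      suc M * L            ∎
    Z₄≤ : suc ((98 * n) / L) ≤ 196 * M
    Z₄≤ = ≤-trans (m<n*o⇒m/o<n {98 * n} {98 * suc M} {L} (<-≤-trans (*-monoʳ-< 98 n<LM+L)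
        (≤-reflexive (sym (*-assoc 98 (suc M) L)))))
      (lin (98 * suc M) (196 * M) 0 (98 ⊠ 1≤M) (e M))
      where
      e : ∀ M → 98 * suc M + 98 * M + 0 ≡ 196 * M + 98 * 1
      e = solve-∀
    M^d≤ : M * M ^ m ≤ 2 ^ suc m * n ^ m
    M^d≤ = *-cancelʳ-≤ _ _ n (begin
      M ^ suc m * n                          ≤⟨ *-monoʳ-≤ (M ^ suc m) (<⇒≤ hi) ⟩
      M ^ suc m * suc L ^ suc m              ≤⟨ *-monoʳ-≤ (M ^ suc m) (^-monoˡ-≤ (suc m) (lin (suc L) (2 * L) 0
          (s≤s (z≤n {L₀})) (e₀ L))) ⟩
      M ^ suc m * (2 * L) ^ suc m            ≡⟨ cong (M ^ suc m *_) (*-^-distrib (suc m) 2 L) ⟩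
      M ^ suc m * (2 ^ suc m * L ^ suc m)    ≡⟨ e₂ (M ^ suc m) (2 ^ suc m) (L ^ suc m) ⟩
      2 ^ suc m * (M ^ suc m * L ^ suc m)    ≡⟨ cong (2 ^ suc m *_) (*-^-distrib (suc m) M L) ⟨
      2 ^ suc m * (M * L) ^ suc m            ≤⟨ *-monoʳ-≤ (2 ^ suc m) (^-monoˡ-≤ (suc m) (m/n*n≤m n L)) ⟩
      2 ^ suc m * n ^ suc m                  ≡⟨ e₃ (2 ^ suc m) n (n ^ m) ⟩
      2 ^ suc m * n ^ m * n                  ∎)
      where
      e₂ : ∀ x y z → x * (y * z) ≡ y * (x * z)
      e₂ = solve-∀
      e₃ : ∀ x n y → x * (n * y) ≡ x * y * n
      e₃ = solve-∀

  C₁ : ℕ → ℕ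
  C₁ m = suc m * 2 ^ m * 4000 * 82 ^ m * (13 ^ m + 2 * 196 ^ m * 2 ^ suc m)

  total : ∀ m n L₀ κ → suc L₀ ^ suc m ≤ n → n < suc (suc L₀) ^ suc m → .{{_ : NonZero n}} →
    suc m * (suc κ * (2 ^ m * (4000 * suc (81 * suc L₀) ^ m))) * (suc (12 * n) ^ m + suc (n / suc L₀) * suc
        ((98 * n) / suc L₀) ^ m) ≤
    C₁ m * suc κ * (suc L₀ ^ m * n ^ m)
  total m n L₀ κ lo hi = begin
    suc m * (suc κ * (2 ^ m * (c * suc (81 * L) ^ m))) * (suc (12 * n) ^ m + suc (n / L) * suc ((98 * n) / L) ^ m)
      ≤⟨ *-mono-≤ (*-monoʳ-≤ (suc m) (*-monoʳ-≤ (suc κ) (*-monoʳ-≤ (2 ^ m) (*-monoʳ-≤ c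
          (≤-trans (^-monoˡ-≤ m (lin (suc (81 * L)) (82 * L) 0 (s≤s (z≤n {L₀})) (e₀ L)))
              (≤-reflexive (*-^-distrib m 82 L)))))))
         (+-mono-≤ (≤-trans (^-monoˡ-≤ m (lin (suc (12 * n)) (13 * n) 0 (>-nonZero⁻¹ n) (e₁ n)))
             (≤-reflexive (*-^-distrib m 13 n)))
                   (rises×codes≤ m n L₀ lo hi)) ⟩
    suc m * (suc κ * (2 ^ m * (c * (82 ^ m * L ^ m)))) * (13 ^ m * n ^ m + 2 * 196 ^ m * 2 ^ suc m * n ^ m)
      ≡⟨ e₂ (suc m) (suc κ) (2 ^ m) c (82 ^ m) (L ^ m) (13 ^ m) (n ^ m) (2 * 196 ^ m * 2 ^ suc m) ⟩
    C₁ m * suc κ * (L ^ m * n ^ m) ∎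
    where
    open ≤-Reasoning
    L c : ℕ
    L = suc L₀
    c = 4000
    e₀ : ∀ L → suc (81 * L) + L + 0 ≡ 82 * L + 1
    e₀ = solve-∀
    e₁ : ∀ n → suc (12 * n) + n + 0 ≡ 13 * n + 1
    e₁ = solve-∀
    e₂ : ∀ a b x c y z u v w → a * (b * (x * (c * (y * z)))) * (u * v + w * v) ≡
        a * x * c * y * (u + w) * b * (z * v)
    e₂ = solve-∀

  ^-cancelˡ-≤ : ∀ {x y} → 2 ^ x ≤ 2 ^ y → x ≤ y
  ^-cancelˡ-≤ {x} {y} p = ≮⇒≥ λ y<x → <⇒≱ (^-monoʳ-< 2 ≤-refl y<x) p

  -- The factor 2 arises because 2^κ ≤ n and n^q ≤ 2^p give κ q ≤ p, hence (κ + 1) q ≤ 2 p.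
  at-most : ∀ m n L₀ κ s C → 2 ≤ n → 2 ^ κ ≤ n → suc L₀ ^ suc m ≤ n → s ≤ C * suc κ * (suc L₀ ^ m * n ^ m) →
    AtMost-C·n^[d-1/d]·log-n (suc m) (2 * C) n s
  at-most m n L₀ κ s C 2≤n 2^κ≤n lo s≤ p q 0<q n^q≤2^p = begin
    (s * q) ^ d                                           ≤⟨ ^-monoˡ-≤ d (*-monoˡ-≤ q s≤) ⟩
    (C * suc κ * (L ^ m * n ^ m) * q) ^ d                 ≡⟨ cong (_^ d) (e₁ C κ (L ^ m * n ^ m) q) ⟩
    (C * (κ * q + q) * (L ^ m * n ^ m)) ^ d               ≤⟨ ^-monoˡ-≤ d (*-monoˡ-≤ (L ^ m * n ^ m)
        (*-monoʳ-≤ C (+-mono-≤ κq≤p q≤p))) ⟩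
    (C * (p + p) * (L ^ m * n ^ m)) ^ d                   ≡⟨ cong (λ z → (z * (L ^ m * n ^ m)) ^ d) (e₂ C p) ⟩
    (2 * C * p * (L ^ m * n ^ m)) ^ d                     ≡⟨ *-^-distrib d (2 * C * p) (L ^ m * n ^ m) ⟩
    (2 * C * p) ^ d * (L ^ m * n ^ m) ^ d                 ≡⟨ cong ((2 * C * p) ^ d *_) (*-^-distrib d (L ^ m)
        (n ^ m)) ⟩
    (2 * C * p) ^ d * ((L ^ m) ^ d * (n ^ m) ^ d)         ≡⟨ cong₂ (λ x y → (2 * C * p) ^ d * (x * y)) L^m^d
        (^-*-assoc n m d) ⟩
    -- Here L^d ≤ n removes L. The exponent becomes m + md, which is d² - 1 for d = m + 1.
    (2 * C * p) ^ d * ((L ^ d) ^ m * n ^ (m * d))         ≤⟨ *-monoʳ-≤ ((2 * C * p) ^ d) (*-monoˡ-≤ (n ^ (m * d))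
        (^-monoˡ-≤ m lo)) ⟩
    (2 * C * p) ^ d * (n ^ m * n ^ (m * d))               ≡⟨ cong ((2 * C * p) ^ d *_) (^-distribˡ-+-* n m
        (m * d)) ⟨
    (2 * C * p) ^ d * n ^ (d * d ∸ 1)                     ∎
    where
    open ≤-Reasoning
    d L : ℕ
    d = suc m
    L = suc L₀
    e₁ : ∀ C κ x q → C * suc κ * x * q ≡ C * (κ * q + q) * x
    e₁ = solve-∀
    e₂ : ∀ C p → C * (p + p) ≡ 2 * C * p
    e₂ = solve-∀
    L^m^d : (L ^ m) ^ d ≡ (L ^ d) ^ m
    L^m^d = trans (^-*-assoc L m d) (trans (cong (L ^_) (*-comm m d)) (sym (^-*-assoc L d m)))
    κq≤p : κ * q ≤ p
    κq≤p = ^-cancelˡ-≤ (≤-trans (≤-trans (≤-reflexive (sym (^-*-assoc 2 κ q))) (^-monoˡ-≤ q 2^κ≤n)) n^q≤2^p)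
    q≤p : q ≤ p
    q≤p = ^-cancelˡ-≤ (≤-trans (^-monoˡ-≤ q 2≤n) n^q≤2^p)

  -- From lists of visible cubes to the count

  lookup-injective : ∀ {A : Set} {xs : List A} → Unique xs → ∀ i j → List.lookup xs i ≡ List.lookup xs j → i ≡ j
  lookup-injective (_ ∷ _) F.zero F.zero _ = refl
  lookup-injective {xs = _ ∷ xs} (x∉ ∷ _) F.zero (F.suc j) eq =
      contradiction eq (All.lookup x∉ (∈-lookup {xs = xs} j))
  lookup-injective {xs = _ ∷ xs} (x∉ ∷ _) (F.suc i) F.zero eq = contradiction (sym eq)
      (All.lookup x∉ (∈-lookup {xs = xs} i))
  lookup-injective (_ ∷ u) (F.suc i) (F.suc j) eq = cong F.suc (lookup-injective u i j eq)

  split-at : ∀ {m} {P : Fin (suc m) → Set} i → P i → (∀ l → P (punchIn i l)) → ∀ j → P j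
  split-at {P = P} i Pi Pl j with i F.≟ j
  ... | yes refl = Pi
  ... | no i≢j = subst P (F.punchIn-punchOut i≢j) (Pl (punchOut i≢j))

  cube-≡ : ∀ {m n} (Q Q′ : Cube (suc m) n) i i′ → i ≡ i′ → corner Q i ≡ corner Q′ i′ →
    (∀ l → corner Q (punchIn i l) ≡ corner Q′ (punchIn i′ l)) → Q ≡ Q′
  cube-≡ Q Q′ i _ refl h≡ a≡ = trans (sym (tabulate∘lookup Q)) (trans
    (tabulate-cong (split-at {P = λ l → Vec.lookup Q l ≡ Vec.lookup Q′ l} i (F.toℕ-injective h≡)
        (F.toℕ-injective ∘ a≡))) (tabulate∘lookup Q′))

  hidden : ∀ {m} (i i′ : Fin (suc m)) (σ : Fin (suc m) → Bool) (a a′ : Fin (suc m) → ℕ) H → i ≡ i′ → a i ≡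
      a′ i′ + H → 1 ≤ H → 2 ≤ a′ i′ →
    (∀ l → ∃[ W ] a (punchIn i l) ≡ a′ (punchIn i′ l) + W ×
       Passes (σ (punchIn i l)) H W (a i) (a (punchIn i l)) (a′ i′) (a′ (punchIn i′ l))) → Hidden i σ a a′ H
  hidden i _ σ a a′ H refl h≡ 1≤H 2≤h′ passes = h≡ , 1≤H , 2≤h′ ,
    split-at {P = λ l → i ≢ l → ∃[ W ] a l ≡ a′ l + W × Passes (σ l) H W (a i) (a l) (a′ i) (a′ l)} i (λ i≢i →
        contradiction refl i≢i) (λ l _ → passes l)

  module Family {m n : ℕ} (O : Pred (Cube (suc m) n) 0ℓ) (xs : List (Cube (suc m) n)) (unique : Unique xs)
    (visible : All (λ Q → Q ∈ O × Visible O Q) xs) where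

    Q : Fin (length xs) → Cube (suc m) n
    Q = List.lookup xs

    inO : ∀ j → Q j ∈ O
    inO j = proj₁ (All.lookup visible (∈-lookup {xs = xs} j))

    vis : ∀ j → Visible O (Q j)
    vis j = proj₂ (All.lookup visible (∈-lookup {xs = xs} j))

    opaque
      unhid : ∀ j → ∃[ i ] ∃[ σ ] (∀ l → corner (Q j) l ≤ corner (Q j) i + 6) ×
        (∀ Q′ → Q′ ∈ O → ∀ H → ¬ Hidden i σ (corner (Q j)) (corner Q′) H)
      unhid j = visible⇒unhidden O (Q j) (vis j)

    ax : Fin (length xs) → Fin (suc m)
    ax j = proj₁ (unhid j)

    count : 2 ≤ n → ∀ L₀ κ → n < 2 ^ suc κ → suc L₀ ^ suc m ≤ n → n < suc (suc L₀) ^ suc m →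
      length xs ≤ C₁ m * suc κ * (suc L₀ ^ m * n ^ m)
    count 2≤n L₀ κ n< lo hi = ≤-trans counted (total m n L₀ κ lo hi {{>-nonZero (≤-trans (s≤s z≤n) 2≤n)}})
      where
      -- Height is measured along each cube's own axis and `punchIn` enumerates the other m
      -- coordinates. Classes record the axis, so only cubes with a common axis are compared.
      module C = Count m n L₀ κ (length xs) n< ax (λ j l → proj₁ (proj₂ (unhid j)) (punchIn (ax j) l))
        (λ j → corner (Q j) (ax j)) (λ j l → corner (Q j) (punchIn (ax j) l))
        (λ j → F.toℕ<n (Vec.lookup (Q j) (ax j))) (λ j l → proj₁ (proj₂ (proj₂ (unhid j))) (punchIn (ax j) l))
        (λ j j′ ax≡ h≡ co≡ → lookup-injective unique j j′ (cube-≡ (Q j) (Q j′) (ax j) (ax j′) ax≡ h≡ co≡))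
        (λ j j′ H ax≡ h≡ 1≤H 2≤h′ passes → proj₂ (proj₂ (proj₂ (unhid j))) (Q j′) (inO j′) H
           (hidden (ax j) (ax j′) (proj₁ (proj₂ (unhid j))) (corner (Q j)) (corner (Q j′)) H ax≡ h≡ 1≤H 2≤h′
               passes))
      counted : length xs ≤ suc m * (suc κ * (2 ^ m * (4000 * suc (81 * suc L₀) ^ m))) * (suc (12 * n) ^ m
          + suc (n / suc L₀) * suc ((98 * n) / suc L₀) ^ m)
      counted = subst (length xs ≤_) (cong₂ _*_ C.Z₁≡ (cong₂ _+_ C.Z₂≡ (cong₂ (λ x y → x * y ^ m) C.Z₃≡ C.Z₄≡)))
          C.count

open import Data.List using (length)
open import Data.Nat using (ℕ; suc; _*_; _≤_; _<_)
open import Data.Product using (∃-syntax; _×_; _,_)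
open import Level using (0ℓ)
open import Relation.Nullary using (¬_)
open import Relation.Unary using (Pred; _∈_)
open Counting using (log₂-bracket)
open Bound

theorem8p1 : (d : ℕ) → 2 < d →
    ∃[ C ] ((n : ℕ) → 2 ≤ n →
    (O : Pred (Cube d n) 0ℓ) → (∀ Q → Q ∈ O → ¬ IsObserver Q) →
    NumberOf (λ Q → Q ∈ O × Visible O Q)
    Satisfies AtMost-C·n^[d-1/d]·log-n d C n)
theorem8p1 (suc m) 2<d = 2 * C₁ m , λ { (suc n₀) 2≤n O _ xs unique visible →
  let (κ , 2^κ≤n , n<) = log₂-bracket n₀
      (L₀ , lo , hi) = nth-root (suc m) n₀
  in at-most m (suc n₀) L₀ κ (length xs) (C₁ m) 2≤n 2^κ≤n lo
       (Family.count O xs unique visible 2≤n L₀ κ n< lo hi) }
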